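{- The hypergraph $\mathsf H_{21}$ (defined in the context) has no faithful orthogonal representation in $\mathbb R^3$.
   Context: Inner product: $\langle x,y\rangle=\sum_{k}\overline{x_k}\,y_k$ (over $\mathbb R$, the standard dot product). Faithful orthogonal representation: let $\mathsf H=(V,\mathcal E)$ be a three-uniform hypergraph, $\mathbb F\in\{\mathbb R,\mathbb C\}$ and $d\ge 3$. A faithful orthogonal representation of $\mathsf H$ in $\mathbb F^d$ assigns to every $v\in V$ a nonzero vector $x_v\in\mathbb F^d$ such that (1) distinct vertices determine distinct rays (one-dimensional subspaces), and (2) for distinct $u,v\in V$, $\langle x_u,x_v\rangle=0$ if and only if $u$ and $v$ belong to a common hyperedge. The hypergraph $\mathsf H_{21}$: it has 21 vertices, namely $v_0,\ldots,v_7$ (midpoints), $v_{01},v_{12},v_{23},v_{34},v_{45},v_{56},v_{67},v_{70}$ (corners; also written $v_{j,j+1}$ with indices modulo $8$), $a_1,a_2,b_1,b_2$, and $c$. It has 14 hyperedges: $E_j=\{v_{j-1,j},\,v_j,\,v_{j,j+1}\}$ for $j=0,\ldots,7$ (indices modulo $8$); $D_0=\{v_0,a_1,v_4\}$, $D_2=\{v_2,a_2,v_6\}$, $D_1=\{v_1,b_2,v_5\}$, $D_3=\{v_3,b_1,v_7\}$; $F_a=\{a_1,c,a_2\}$, $F_b=\{b_1,c,b_2\}$. -}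

module Defs where

open import Algebra.Bundles.Raw using (RawRing)
import Algebra.Definitions.RawMonoid as RawMonoidOps
open import Algebra.Bundles using (CommutativeRing)
import Algebra.Properties.CommutativeSemigroup as CommutativeSemigroupProperties
open import Data.Fin.Base using (Fin; zero; suc; fromℕ; inject₁)
open import Data.Fin.Patterns
open import Data.Nat.Base as ℕ using (ℕ; suc)
import Data.Nat.Properties as ℕ
open import Data.Product.Base using (∃-syntax; _×_; _,_)
open import Data.Rational.Base as ℚ using (ℚ; 0ℚ; 1ℚ; ½)
import Data.Rational.Properties as ℚ
open import Data.Vec.Base using (Vec; []; _∷_)
open import Data.Vec.Functional using (Vector)
open import Data.Vec.Functional.Relation.Binary.Pointwise using (Pointwise)
open import Data.Vec.Membership.Propositional using (_∈_)
open import Data.Vec.Relation.Unary.All using ([]; _∷_)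
open import Data.Vec.Relation.Unary.AllPairs using ([]; _∷_)
open import Data.Vec.Relation.Unary.Unique.Propositional using (Unique)
open import Function.Bundles using (_⇔_)
open import Level using (0ℓ)
open import Relation.Binary.Core using (Rel)
open import Relation.Binary.PropositionalEquality
  using (_≡_; _≢_; refl; sym; cong; cong₂; subst)
open import Relation.Nullary.Negation.Core using (¬_)
open import Relation.Unary using (Pred; _≐_)

-- ℝ is the setoid of Cauchy sequences of rationals, where x ≈ y means that
-- the difference is a null sequence.

IsCauchy : (ℕ → ℚ) → Set
IsCauchy x = ∀ ε → 0ℚ ℚ.< ε →
  ∃[ N ] (∀ m n → N ℕ.≤ m → N ℕ.≤ n → ℚ.∣ x m ℚ.- x n ∣ ℚ.< ε)

record ℝ : Set where
  constructor mkℝ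
  field
    seq      : ℕ → ℚ
    isCauchy : IsCauchy seq

open ℝ public

infix 4 _≈_
_≈_ : Rel ℝ 0ℓ
x ≈ y = ∀ ε → 0ℚ ℚ.< ε →
  ∃[ N ] (∀ n → N ℕ.≤ n → ℚ.∣ seq x n ℚ.- seq y n ∣ ℚ.< ε)

fromℚ : ℚ → ℝ
fromℚ q = mkℝ (λ _ → q) λ ε 0<ε → 0 , λ _ _ _ _ →
  subst (ℚ._< ε) (sym (cong ℚ.∣_∣ (ℚ.+-inverseʳ q))) 0<ε

private
  open CommutativeSemigroupProperties
    (CommutativeRing.+-commutativeSemigroup ℚ.+-*-commutativeRing)
    using (interchange)

  half>0 : ∀ {ε} → 0ℚ ℚ.< ε → 0ℚ ℚ.< ½ ℚ.* ε
  half>0 {ε} 0<ε =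
    ℚ.positive⁻¹ (½ ℚ.* ε) {{ℚ.pos*pos⇒pos ½ ε {{ℚ.positive 0<ε}}}}

  halves : ∀ ε → ½ ℚ.* ε ℚ.+ ½ ℚ.* ε ≡ ε
  halves ε = begin-equality
    ½ ℚ.* ε ℚ.+ ½ ℚ.* ε  ≡⟨ ℚ.*-distribʳ-+ ε ½ ½ ⟨
    (½ ℚ.+ ½) ℚ.* ε      ≡⟨ ℚ.*-identityˡ ε ⟩
    ε                    ∎
    where open ℚ.≤-Reasoning

  ∣p+q∣<ε : ∀ {ε} p q → ℚ.∣ p ∣ ℚ.< ½ ℚ.* ε → ℚ.∣ q ∣ ℚ.< ½ ℚ.* ε →
            ℚ.∣ p ℚ.+ q ∣ ℚ.< ε
  ∣p+q∣<ε {ε} p q p< q< = begin-strict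
    ℚ.∣ p ℚ.+ q ∣           ≤⟨ ℚ.∣p+q∣≤∣p∣+∣q∣ p q ⟩
    ℚ.∣ p ∣ ℚ.+ ℚ.∣ q ∣     <⟨ ℚ.+-mono-< p< q< ⟩
    ½ ℚ.* ε ℚ.+ ½ ℚ.* ε     ≡⟨ halves ε ⟩
    ε                       ∎
    where open ℚ.≤-Reasoning

  +-diff : ∀ a b c d →
    (a ℚ.+ b) ℚ.- (c ℚ.+ d) ≡ (a ℚ.- c) ℚ.+ (b ℚ.- d)
  +-diff a b c d = begin-equality
    (a ℚ.+ b) ℚ.- (c ℚ.+ d)              ≡⟨ cong ((a ℚ.+ b) ℚ.+_) (ℚ.neg-distrib-+ c d) ⟩
    (a ℚ.+ b) ℚ.+ ((ℚ.- c) ℚ.+ (ℚ.- d))  ≡⟨ interchange a b (ℚ.- c) (ℚ.- d) ⟩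
    (a ℚ.- c) ℚ.+ (b ℚ.- d)              ∎
    where open ℚ.≤-Reasoning

  telescope : ∀ a b c → (a ℚ.- b) ℚ.+ (b ℚ.+ c) ≡ a ℚ.+ c
  telescope a b c = begin-equality
    (a ℚ.- b) ℚ.+ (b ℚ.+ c)        ≡⟨ ℚ.+-assoc a (ℚ.- b) (b ℚ.+ c) ⟩
    a ℚ.+ ((ℚ.- b) ℚ.+ (b ℚ.+ c))  ≡⟨ cong (a ℚ.+_) (ℚ.+-assoc (ℚ.- b) b c) ⟨
    a ℚ.+ ((ℚ.- b) ℚ.+ b ℚ.+ c)    ≡⟨ cong (λ z → a ℚ.+ (z ℚ.+ c)) (ℚ.+-inverseˡ b) ⟩
    a ℚ.+ (0ℚ ℚ.+ c)               ≡⟨ cong (a ℚ.+_) (ℚ.+-identityˡ c) ⟩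
    a ℚ.+ c                        ∎
    where open ℚ.≤-Reasoning

  *-diff : ∀ a b c d →
    (a ℚ.* b) ℚ.- (c ℚ.* d) ≡ a ℚ.* (b ℚ.- d) ℚ.+ d ℚ.* (a ℚ.- c)
  *-diff a b c d = begin-equality
    a ℚ.* b ℚ.- c ℚ.* d
      ≡⟨ telescope (a ℚ.* b) (a ℚ.* d) (ℚ.- (c ℚ.* d)) ⟨
    (a ℚ.* b ℚ.- a ℚ.* d) ℚ.+ (a ℚ.* d ℚ.- c ℚ.* d)
      ≡⟨ cong₂ ℚ._+_ (factor a b d) (cong₂ ℚ._-_ (ℚ.*-comm a d) (ℚ.*-comm c d)) ⟩
    a ℚ.* (b ℚ.- d) ℚ.+ (d ℚ.* a ℚ.- d ℚ.* c)
      ≡⟨ cong (a ℚ.* (b ℚ.- d) ℚ.+_) (factor d a c) ⟩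
    a ℚ.* (b ℚ.- d) ℚ.+ d ℚ.* (a ℚ.- c)
      ∎
    where
    open ℚ.≤-Reasoning
    factor : ∀ p q r → p ℚ.* q ℚ.- p ℚ.* r ≡ p ℚ.* (q ℚ.- r)
    factor p q r = begin-equality
      p ℚ.* q ℚ.- p ℚ.* r        ≡⟨ cong (p ℚ.* q ℚ.+_) (ℚ.neg-distribʳ-* p r) ⟩
      p ℚ.* q ℚ.+ p ℚ.* (ℚ.- r)  ≡⟨ ℚ.*-distribˡ-+ p q (ℚ.- r) ⟨
      p ℚ.* (q ℚ.- r)            ∎

  -- Only the tail of the sequence is bounded; that is all _*_ needs.
  bound : ∀ {x} → IsCauchy x →
    ∃[ K ] (0ℚ ℚ.< K × ∃[ N ] (∀ n → N ℕ.≤ n → ℚ.∣ x n ∣ ℚ.< K))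
  bound {x} cx with cx 1ℚ (ℚ.positive⁻¹ 1ℚ)
  ... | N , close = K , 0<K , N , below
    where
    open ℚ.≤-Reasoning
    K = 1ℚ ℚ.+ ℚ.∣ x N ∣

    0<K : 0ℚ ℚ.< K
    0<K = ℚ.+-mono-<-≤ (ℚ.positive⁻¹ 1ℚ) (ℚ.0≤∣p∣ (x N))

    split : ∀ a b → a ≡ (a ℚ.- b) ℚ.+ b
    split a b = begin-equality
      a                        ≡⟨ ℚ.+-identityʳ a ⟨
      a ℚ.+ 0ℚ                 ≡⟨ telescope a b 0ℚ ⟨
      (a ℚ.- b) ℚ.+ (b ℚ.+ 0ℚ) ≡⟨ cong ((a ℚ.- b) ℚ.+_) (ℚ.+-identityʳ b) ⟩
      (a ℚ.- b) ℚ.+ b          ∎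

    below : ∀ n → N ℕ.≤ n → ℚ.∣ x n ∣ ℚ.< K
    below n N≤n = begin-strict
      ℚ.∣ x n ∣                          ≡⟨ cong ℚ.∣_∣ (split (x n) (x N)) ⟩
      ℚ.∣ (x n ℚ.- x N) ℚ.+ x N ∣        ≤⟨ ℚ.∣p+q∣≤∣p∣+∣q∣ (x n ℚ.- x N) (x N) ⟩
      ℚ.∣ x n ℚ.- x N ∣ ℚ.+ ℚ.∣ x N ∣    <⟨ ℚ.+-monoˡ-< ℚ.∣ x N ∣ (close n N N≤n ℕ.≤-refl) ⟩
      K                                  ∎

  small : ∀ {ε} → 0ℚ ℚ.< ε → ∀ K → 0ℚ ℚ.< K →
    ∃[ δ ] (0ℚ ℚ.< δ × K ℚ.* δ ≡ ε)
  small {ε} 0<ε K 0<K = 1/K ℚ.* ε , ℚ.positive⁻¹ (1/K ℚ.* ε) , eq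
    where
    instance
      K>0   = ℚ.positive 0<K
      ε>0   = ℚ.positive 0<ε
      K≢0   = ℚ.pos⇒nonZero K
    1/K = ℚ.1/ K
    instance
      1/K>0 = ℚ.1/pos⇒pos K
      δ>0   = ℚ.pos*pos⇒pos 1/K ε
    open ℚ.≤-Reasoning
    eq : K ℚ.* (1/K ℚ.* ε) ≡ ε
    eq = begin-equality
      K ℚ.* (1/K ℚ.* ε)  ≡⟨ ℚ.*-assoc K 1/K ε ⟨
      K ℚ.* 1/K ℚ.* ε    ≡⟨ cong (ℚ._* ε) (ℚ.*-inverseʳ K) ⟩
      1ℚ ℚ.* ε           ≡⟨ ℚ.*-identityˡ ε ⟩
      ε                  ∎

  ∣p*q∣<ε : ∀ {K δ ε} p q → 0ℚ ℚ.< K → K ℚ.* δ ≡ ε →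
            ℚ.∣ p ∣ ℚ.< K → ℚ.∣ q ∣ ℚ.< δ → ℚ.∣ p ℚ.* q ∣ ℚ.< ε
  ∣p*q∣<ε {K} {δ} {ε} p q 0<K Kδ≡ε p< q< = begin-strict
    ℚ.∣ p ℚ.* q ∣          ≡⟨ ℚ.∣p*q∣≡∣p∣*∣q∣ p q ⟩
    ℚ.∣ p ∣ ℚ.* ℚ.∣ q ∣    ≤⟨ ℚ.*-monoʳ-≤-nonNeg ℚ.∣ q ∣ {{ℚ.nonNegative (ℚ.0≤∣p∣ q)}} (ℚ.<⇒≤ p<) ⟩
    K ℚ.* ℚ.∣ q ∣          <⟨ ℚ.*-monoʳ-<-pos K {{ℚ.positive 0<K}} q< ⟩
    K ℚ.* δ                ≡⟨ Kδ≡ε ⟩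
    ε                      ∎
    where open ℚ.≤-Reasoning

-- The proofs are abstract because ≈ depends on the sequences only.
abstract
  +-isCauchy : ∀ {x y} → IsCauchy x → IsCauchy y → IsCauchy (λ n → x n ℚ.+ y n)
  +-isCauchy {x} {y} cx cy ε 0<ε =
    let M , close-x = cx (½ ℚ.* ε) (half>0 0<ε)
        N , close-y = cy (½ ℚ.* ε) (half>0 0<ε)
    in M ℕ.⊔ N , λ m n m≥ n≥ →
      subst (λ z → ℚ.∣ z ∣ ℚ.< ε) (sym (+-diff (x m) (y m) (x n) (y n)))
        (∣p+q∣<ε (x m ℚ.- x n) (y m ℚ.- y n)
          (close-x m n (ℕ.m⊔n≤o⇒m≤o M N m≥) (ℕ.m⊔n≤o⇒m≤o M N n≥))
          (close-y m n (ℕ.m⊔n≤o⇒n≤o M N m≥) (ℕ.m⊔n≤o⇒n≤o M N n≥)))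

  -‿isCauchy : ∀ {x} → IsCauchy x → IsCauchy (λ n → ℚ.- x n)
  -‿isCauchy {x} cx ε 0<ε =
    let N , close = cx ε 0<ε
    in N , λ m n m≥ n≥ → subst (ℚ._< ε) (sym (∣-∣ (x m) (x n))) (close m n m≥ n≥)
    where
    open ℚ.≤-Reasoning
    ∣-∣ : ∀ a b → ℚ.∣ (ℚ.- a) ℚ.- (ℚ.- b) ∣ ≡ ℚ.∣ a ℚ.- b ∣
    ∣-∣ a b = begin-equality
      ℚ.∣ (ℚ.- a) ℚ.- (ℚ.- b) ∣  ≡⟨ cong ℚ.∣_∣ (ℚ.neg-distrib-+ a (ℚ.- b)) ⟨
      ℚ.∣ ℚ.- (a ℚ.- b) ∣        ≡⟨ ℚ.∣-p∣≡∣p∣ (a ℚ.- b) ⟩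
      ℚ.∣ a ℚ.- b ∣              ∎

  *-isCauchy : ∀ {x y} → IsCauchy x → IsCauchy y → IsCauchy (λ n → x n ℚ.* y n)
  *-isCauchy {x} {y} cx cy ε 0<ε =
    let K , 0<K , M₁ , x<K = bound {x} cx
        L , 0<L , N₁ , y<L = bound {y} cy
        δ , 0<δ , Kδ = small (half>0 0<ε) K 0<K
        η , 0<η , Lη = small (half>0 0<ε) L 0<L
        M₂ , close-x = cx η 0<η
        N₂ , close-y = cy δ 0<δ
    in (M₁ ℕ.⊔ N₁) ℕ.⊔ (M₂ ℕ.⊔ N₂) , λ m n m≥ n≥ →
      let m≥₁ = ℕ.m⊔n≤o⇒m≤o (M₁ ℕ.⊔ N₁) (M₂ ℕ.⊔ N₂) m≥
          m≥₂ = ℕ.m⊔n≤o⇒n≤o (M₁ ℕ.⊔ N₁) (M₂ ℕ.⊔ N₂) m≥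
          n≥₁ = ℕ.m⊔n≤o⇒m≤o (M₁ ℕ.⊔ N₁) (M₂ ℕ.⊔ N₂) n≥
          n≥₂ = ℕ.m⊔n≤o⇒n≤o (M₁ ℕ.⊔ N₁) (M₂ ℕ.⊔ N₂) n≥
      in subst (λ z → ℚ.∣ z ∣ ℚ.< ε) (sym (*-diff (x m) (y m) (x n) (y n)))
        (∣p+q∣<ε (x m ℚ.* (y m ℚ.- y n)) (y n ℚ.* (x m ℚ.- x n))
          (∣p*q∣<ε (x m) (y m ℚ.- y n) 0<K Kδ
            (x<K m (ℕ.m⊔n≤o⇒m≤o M₁ N₁ m≥₁))
            (close-y m n (ℕ.m⊔n≤o⇒n≤o M₂ N₂ m≥₂) (ℕ.m⊔n≤o⇒n≤o M₂ N₂ n≥₂)))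
          (∣p*q∣<ε (y n) (x m ℚ.- x n) 0<L Lη
            (y<L n (ℕ.m⊔n≤o⇒n≤o M₁ N₁ n≥₁))
            (close-x m n (ℕ.m⊔n≤o⇒m≤o M₂ N₂ m≥₂) (ℕ.m⊔n≤o⇒m≤o M₂ N₂ n≥₂))))

infix  8 -_
infixl 7 _*_
infixl 6 _+_

_+_ : ℝ → ℝ → ℝ
mkℝ x cx + mkℝ y cy = mkℝ (λ n → x n ℚ.+ y n) (+-isCauchy {x} {y} cx cy)

-_ : ℝ → ℝ
- mkℝ x cx = mkℝ (λ n → ℚ.- x n) (-‿isCauchy {x} cx)

_*_ : ℝ → ℝ → ℝ
mkℝ x cx * mkℝ y cy = mkℝ (λ n → x n ℚ.* y n) (*-isCauchy {x} {y} cx cy)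

0ℝ 1ℝ : ℝ
0ℝ = fromℚ 0ℚ
1ℝ = fromℚ 1ℚ

ℝ-rawRing : RawRing 0ℓ 0ℓ
ℝ-rawRing = record
  { Carrier = ℝ ; _≈_ = _≈_
  ; _+_ = _+_ ; _*_ = _*_ ; -_ = -_ ; 0# = 0ℝ ; 1# = 1ℝ
  }

open RawMonoidOps (RawRing.+-rawMonoid ℝ-rawRing) public using (sum)

infix 4 _≋_
_≋_ : ∀ {d} → Rel (Vector ℝ d) 0ℓ
_≋_ = Pointwise _≈_

0ᵛ : ∀ {d} → Vector ℝ d
0ᵛ _ = 0ℝ

infixr 7 _·_
_·_ : ∀ {d} → ℝ → Vector ℝ d → Vector ℝ d
(t · x) k = t * x k

⟨_,_⟩ : ∀ {d} → Vector ℝ d → Vector ℝ d → ℝ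
⟨ x , y ⟩ = sum (λ k → x k * y k)

-- The subspace spanned by x, which is a ray when x is nonzero.
span : ∀ {d} → Vector ℝ d → Pred (Vector ℝ d) 0ℓ
span x y = ∃[ t ] y ≋ t · x

-- A hyperedge is given by a listing of its three distinct vertices. The
-- order of the listing is irrelevant, since only membership is ever used.
record ThreeUniformHypergraph : Set₁ where
  field
    V       : Set
    𝓔       : Pred (Vec V 3) 0ℓ
    uniform : ∀ {e} → 𝓔 e → Unique e

  ShareHyperedge : V → V → Set
  ShareHyperedge u v = ∃[ e ] (𝓔 e × u ∈ e × v ∈ e)

record FaithfulOrthogonalRepresentation
         (H : ThreeUniformHypergraph) (d : ℕ) : Set where
  open ThreeUniformHypergraph H
  field
    vec          : V → Vector ℝ d
    nonzero      : ∀ v → ¬ (vec v ≋ 0ᵛ)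
    distinctRays : ∀ {u v} → u ≢ v → ¬ (span (vec u) ≐ span (vec v))
    orthogonal   : ∀ {u v} → u ≢ v →
                   (⟨ vec u , vec v ⟩ ≈ 0ℝ) ⇔ ShareHyperedge u v

-- j ↦ j − 1 modulo 8
pred₈ : Fin 8 → Fin 8
pred₈ zero    = fromℕ 7
pred₈ (suc j) = inject₁ j

-- mid j is vⱼ, and corner j is vⱼ,ⱼ₊₁ with indices modulo 8.
data Vertex₂₁ : Set where
  mid corner        : Fin 8 → Vertex₂₁
  a₁ a₂ b₁ b₂ c     : Vertex₂₁

data Hyperedge₂₁ : Pred (Vec Vertex₂₁ 3) 0ℓ where
  E  : ∀ j → Hyperedge₂₁ (corner (pred₈ j) ∷ mid j ∷ corner j ∷ [])
  D₀ : Hyperedge₂₁ (mid 0F ∷ a₁ ∷ mid 4F ∷ [])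
  D₂ : Hyperedge₂₁ (mid 2F ∷ a₂ ∷ mid 6F ∷ [])
  D₁ : Hyperedge₂₁ (mid 1F ∷ b₂ ∷ mid 5F ∷ [])
  D₃ : Hyperedge₂₁ (mid 3F ∷ b₁ ∷ mid 7F ∷ [])
  Fa : Hyperedge₂₁ (a₁ ∷ c ∷ a₂ ∷ [])
  Fb : Hyperedge₂₁ (b₁ ∷ c ∷ b₂ ∷ [])

private
  pred₈-≢ : ∀ j → corner (pred₈ j) ≢ corner j
  pred₈-≢ 0F ()
  pred₈-≢ 1F ()
  pred₈-≢ 2F ()
  pred₈-≢ 3F ()
  pred₈-≢ 4F ()
  pred₈-≢ 5F ()
  pred₈-≢ 6F ()
  pred₈-≢ 7F ()

  unique : ∀ {x y z : Vertex₂₁} → x ≢ y → x ≢ z → y ≢ z → Unique (x ∷ y ∷ z ∷ [])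
  unique p q r = (p ∷ q ∷ []) ∷ (r ∷ []) ∷ [] ∷ []

H₂₁ : ThreeUniformHypergraph
H₂₁ = record { V = Vertex₂₁ ; 𝓔 = Hyperedge₂₁ ; uniform = uniform }
  where
  uniform : ∀ {e} → Hyperedge₂₁ e → Unique e
  uniform (E j) = unique (λ ()) (pred₈-≢ j) (λ ())
  uniform D₀    = unique (λ ()) (λ ()) (λ ())
  uniform D₂    = unique (λ ()) (λ ()) (λ ())
  uniform D₁    = unique (λ ()) (λ ()) (λ ())
  uniform D₃    = unique (λ ()) (λ ()) (λ ())
  uniform Fa    = unique (λ ()) (λ ()) (λ ())
  uniform Fb    = unique (λ ()) (λ ()) (λ ())

{-# OPTIONS --safe #-}
module Submission where

-- Suppose vectors v₀, v₁, …, a₁, a₂, c represent H₂₁ in ℝ³, and take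
-- coordinates x, y, z along the orthogonal frame a₁, a₂, c. Expanding in the
-- basis v₀₁, v₁, v₁₂ turns v₀₁ ⊥ v₁₂ into
--   ⟨v₀,v₂⟩⟨v₁,v₁⟩ = ⟨v₀,v₁⟩⟨v₁,v₂⟩,
-- and likewise for v₄, v₅, v₆. Now v₀ and v₄ are orthogonal in the plane a₁^⊥,
-- v₂ and v₆ in a₂^⊥, v₁ and v₅ in b₂^⊥, which contains c; so v₄, v₅, v₆ are
-- determined up to scale by v₀, v₁, v₂. For orthonormal a₁, a₂, c, eliminating
-- z₁ from the two equations leaves
--   x₁y₁y₀z₀x₂z₂ = (x₁² + y₁²)(y₀² + z₀²)(x₂² + z₂²),
-- which is impossible: with u = x₁y₀z₂ and v = y₁z₀x₂ the right side is at least
-- u² + v², and u² + v² > uv since u ≠ 0. Norms cannot be divided out without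
-- square roots, so the frame stays unnormalised and the squares of coordinates
-- carry weights l, m, n.

open import Algebra.Bundles using (CommutativeRing)
import Algebra.Solver.Ring
open import Algebra.Solver.Ring.AlmostCommutativeRing
  using (_-Raw-AlmostCommutative⟶_; fromCommutativeRing)
open import Data.Empty using (⊥)
open import Data.Fin.Base using (Fin; zero; suc)
open import Data.Fin.Patterns
open import Data.Integer.Base as ℤ using (ℤ; +_; -[1+_]; _◃_)
import Data.Integer.Properties as ℤ
open import Data.Maybe.Base using (map)
open import Data.Nat.Base as ℕ using (ℕ; zero; suc)
import Data.Nat.Properties as ℕ
open import Data.Product.Base as Product using (_,_; proj₁; proj₂; ∃-syntax)
open import Data.Rational.Base as ℚ using (ℚ; 0ℚ; 1ℚ; ½)
import Data.Rational.Properties as ℚ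
open import Data.Sign.Base as Sign using (Sign)
open import Data.Sum.Base using (_⊎_; inj₁; inj₂)
open import Data.Unit.Base using (⊤; tt)
import Data.Vec.Base as Vec
open import Data.Vec.Functional using (Vector; tail)
open import Data.Vec.Relation.Unary.All as All using (All; []; _∷_)
open import Data.Vec.Relation.Unary.AllPairs using (_∷_)
open import Data.Vec.Relation.Unary.Any using (here; there)
open import Defs
  using (Vertex₂₁; mid; corner; a₁; a₂; b₂; c; Hyperedge₂₁; E; D₀; D₁; D₂; D₃; Fa; Fb;
         H₂₁; module ThreeUniformHypergraph)
open import Function.Bundles using (_⇔_; module Equivalence)
open import Level using (_⊔_; 0ℓ) renaming (suc to lsuc)
open import Relation.Binary.Consequences using (dec⇒weaklyDec)
open import Relation.Binary.Definitions using (WeaklyDecidable)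
open import Relation.Binary.PropositionalEquality as ≡ using (_≡_; _≢_)
open import Relation.Nullary.Decidable.Core using (Dec; yes; no)
open import Relation.Nullary.Negation.Core using (¬_; contradiction)
open import Relation.Unary using (Pred)

-- Pairs of vertices that lie in no common hyperedge

open ThreeUniformHypergraph H₂₁ using (ShareHyperedge; uniform)

-- Selects the pairs whose non-orthogonality the argument uses.
MayShare : Vertex₂₁ → Vertex₂₁ → Set
MayShare (mid _)  c  = ⊥
MayShare (mid 0F) a₂ = ⊥
MayShare (mid 1F) a₁ = ⊥
MayShare (mid 1F) a₂ = ⊥
MayShare b₂       a₂ = ⊥
MayShare _        _  = ⊤

hyperedge-mayShare : ∀ {e} → Hyperedge₂₁ e → All (λ s → All (MayShare s) e) e
hyperedge-mayShare (E _) = (tt ∷ tt ∷ tt ∷ []) ∷ (tt ∷ tt ∷ tt ∷ []) ∷ (tt ∷ tt ∷ tt ∷ []) ∷ []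
hyperedge-mayShare D₀    = (tt ∷ tt ∷ tt ∷ []) ∷ (tt ∷ tt ∷ tt ∷ []) ∷ (tt ∷ tt ∷ tt ∷ []) ∷ []
hyperedge-mayShare D₂    = (tt ∷ tt ∷ tt ∷ []) ∷ (tt ∷ tt ∷ tt ∷ []) ∷ (tt ∷ tt ∷ tt ∷ []) ∷ []
hyperedge-mayShare D₁    = (tt ∷ tt ∷ tt ∷ []) ∷ (tt ∷ tt ∷ tt ∷ []) ∷ (tt ∷ tt ∷ tt ∷ []) ∷ []
hyperedge-mayShare D₃    = (tt ∷ tt ∷ tt ∷ []) ∷ (tt ∷ tt ∷ tt ∷ []) ∷ (tt ∷ tt ∷ tt ∷ []) ∷ []
hyperedge-mayShare Fa    = (tt ∷ tt ∷ tt ∷ []) ∷ (tt ∷ tt ∷ tt ∷ []) ∷ (tt ∷ tt ∷ tt ∷ []) ∷ []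
hyperedge-mayShare Fb    = (tt ∷ tt ∷ tt ∷ []) ∷ (tt ∷ tt ∷ tt ∷ []) ∷ (tt ∷ tt ∷ tt ∷ []) ∷ []

shareHyperedge⇒mayShare : ∀ {s t} → ShareHyperedge s t → MayShare s t
shareHyperedge⇒mayShare (_ , h , s∈e , t∈e) =
  All.lookup (All.lookup (hyperedge-mayShare h) s∈e) t∈e

-- A polynomial identity solver with integer coefficients

module IntegerCoefficients {a ℓ} (R : CommutativeRing a ℓ) where
  open CommutativeRing R
  open import Algebra.Properties.Ring ring
  open import Algebra.Properties.Semiring.Mult semiring
  open import Relation.Binary.Reasoning.Setoid setoid

  -- The canonical ring homomorphism from the integers. The solver has to compare coefficients:
  -- equality of integers is decidable, while equality in the carrier is not assumed to be.
  ⟦_⟧ℤ : ℤ → Carrier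
  ⟦ + n ⟧ℤ      = n × 1#
  ⟦ -[1+ n ] ⟧ℤ = - (suc n × 1#)

  +-cancel-- : ∀ x y z → (x + y) - (x + z) ≈ y - z
  +-cancel-- x y z = begin
    (x + y) - (x + z)      ≈⟨ +-congˡ (-‿+-comm x z) ⟨
    (x + y) + (- x - z)    ≈⟨ +-congʳ (+-comm x y) ⟩
    (y + x) + (- x - z)    ≈⟨ +-assoc y x _ ⟩
    y + (x + (- x - z))    ≈⟨ +-congˡ (+-assoc x (- x) _) ⟨
    y + ((x - x) - z)      ≈⟨ +-congˡ (+-congʳ (-‿inverseʳ x)) ⟩
    y + (0# - z)           ≈⟨ +-congˡ (+-identityˡ _) ⟩
    y - z                  ∎

  -‿homo : ∀ i → ⟦ ℤ.- i ⟧ℤ ≈ - ⟦ i ⟧ℤ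
  -‿homo (+ zero)   = sym -0#≈0#
  -‿homo (+ suc n)  = refl
  -‿homo -[1+ n ]   = sym (-‿involutive _)

  ⊖-homo : ∀ m n → ⟦ m ℤ.⊖ n ⟧ℤ ≈ m × 1# - n × 1#
  ⊖-homo zero    zero    = sym (-‿inverseʳ 0#)
  ⊖-homo zero    (suc n) = sym (+-identityˡ _)
  ⊖-homo (suc m) zero    = sym (trans (+-congˡ -0#≈0#) (+-identityʳ _))
  ⊖-homo (suc m) (suc n) = begin
    ⟦ suc m ℤ.⊖ suc n ⟧ℤ     ≡⟨ ≡.cong ⟦_⟧ℤ (ℤ.[1+m]⊖[1+n]≡m⊖n m n) ⟩
    ⟦ m ℤ.⊖ n ⟧ℤ             ≈⟨ ⊖-homo m n ⟩
    m × 1# - n × 1#          ≈⟨ +-cancel-- 1# (m × 1#) (n × 1#) ⟨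
    suc m × 1# - suc n × 1#  ∎

  +-homo : ∀ i j → ⟦ i ℤ.+ j ⟧ℤ ≈ ⟦ i ⟧ℤ + ⟦ j ⟧ℤ
  +-homo (+ m)    (+ n)    = ×-homo-+ 1# m n
  +-homo (+ m)    -[1+ n ] = ⊖-homo m (suc n)
  +-homo -[1+ m ] (+ n)    = trans (⊖-homo n (suc m)) (+-comm _ _)
  +-homo -[1+ m ] -[1+ n ] = begin
    - (suc (suc (m ℕ.+ n)) × 1#)     ≡⟨ ≡.cong (λ k → - (suc k × 1#)) (ℕ.+-suc m n) ⟨
    - ((suc m ℕ.+ suc n) × 1#)       ≈⟨ -‿cong (×-homo-+ 1# (suc m) (suc n)) ⟩
    - (suc m × 1# + suc n × 1#)      ≈⟨ -‿+-comm _ _ ⟨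
    - (suc m × 1#) - suc n × 1#      ∎

  +◃-homo : ∀ n → ⟦ Sign.+ ◃ n ⟧ℤ ≈ n × 1#
  +◃-homo zero    = refl
  +◃-homo (suc n) = refl

  -◃-homo : ∀ n → ⟦ Sign.- ◃ n ⟧ℤ ≈ - (n × 1#)
  -◃-homo zero    = sym -0#≈0#
  -◃-homo (suc n) = refl

  *-homo : ∀ i j → ⟦ i ℤ.* j ⟧ℤ ≈ ⟦ i ⟧ℤ * ⟦ j ⟧ℤ
  *-homo (+ m)    (+ n)    = trans (+◃-homo (m ℕ.* n)) (×1-homo-* m n)
  *-homo (+ m)    -[1+ n ] = begin
    ⟦ Sign.- ◃ m ℕ.* suc n ⟧ℤ      ≈⟨ -◃-homo (m ℕ.* suc n) ⟩
    - ((m ℕ.* suc n) × 1#)         ≈⟨ -‿cong (×1-homo-* m (suc n)) ⟩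
    - (m × 1# * (suc n × 1#))      ≈⟨ -‿distribʳ-* _ _ ⟩
    m × 1# * - (suc n × 1#)        ∎
  *-homo -[1+ m ] (+ n)    = begin
    ⟦ Sign.- ◃ suc m ℕ.* n ⟧ℤ      ≈⟨ -◃-homo (suc m ℕ.* n) ⟩
    - ((suc m ℕ.* n) × 1#)         ≈⟨ -‿cong (×1-homo-* (suc m) n) ⟩
    - (suc m × 1# * (n × 1#))      ≈⟨ -‿distribˡ-* _ _ ⟩
    - (suc m × 1#) * (n × 1#)      ∎
  *-homo -[1+ m ] -[1+ n ] = begin
    (suc m ℕ.* suc n) × 1#               ≈⟨ ×1-homo-* (suc m) (suc n) ⟩
    suc m × 1# * (suc n × 1#)            ≈⟨ -‿involutive _ ⟨
    - - (suc m × 1# * (suc n × 1#))      ≈⟨ -‿cong (-‿distribʳ-* _ _) ⟩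
    - (suc m × 1# * - (suc n × 1#))      ≈⟨ -‿distribˡ-* _ _ ⟩
    - (suc m × 1#) * - (suc n × 1#)      ∎

  morphism : ℤ.+-*-rawRing -Raw-AlmostCommutative⟶ fromCommutativeRing R
  morphism = record
    { ⟦_⟧    = ⟦_⟧ℤ
    ; +-homo = +-homo
    ; *-homo = *-homo
    ; -‿homo = -‿homo
    ; 0-homo = refl
    ; 1-homo = ×-homo-1 1#
    }

  _coeff≟_ : WeaklyDecidable (λ i j → ⟦ i ⟧ℤ ≈ ⟦ j ⟧ℤ)
  i coeff≟ j = map (λ { ≡.refl → refl }) (dec⇒weaklyDec ℤ._≟_ i j)

  open Algebra.Solver.Ring ℤ.+-*-rawRing (fromCommutativeRing R) morphism _coeff≟_ public

-- The order and domain axioms used by the geometric argument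

record FormallyRealDomain a ℓ p : Set (lsuc (a ⊔ ℓ ⊔ p)) where
  field
    commutativeRing : CommutativeRing a ℓ
  open CommutativeRing commutativeRing public
  field
    -- Constructively weaker than x ≈ 0# or y ≈ 0#, and does not presuppose
    -- that equality with 0# is decidable.
    split         : ∀ {x y} → x * y ≈ 0# → (y ≈ 0# → x ≈ 0#) → x ≈ 0#
    -- Not required to respect _≈_.
    NonNeg        : Pred Carrier p
    0-nonNeg      : NonNeg 0#
    +-nonNeg      : ∀ {x y} → NonNeg x → NonNeg y → NonNeg (x + y)
    *-nonNeg      : ∀ {x y} → NonNeg x → NonNeg y → NonNeg (x * y)
    square-nonNeg : ∀ x → NonNeg (x * x)
    summand-zero  : ∀ {x y} → NonNeg x → NonNeg y → x + y ≈ 0# → x ≈ 0#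

module Geometry {a ℓ p} (F : FormallyRealDomain a ℓ p) where
  open FormallyRealDomain F

  open import Algebra.Properties.Ring ring
  open Product using (_×_)
  open import Algebra.Properties.Monoid.Sum +-monoid using (sum; sum-cong-≋)
  open import Algebra.Properties.CommutativeSemigroup *-commutativeSemigroup using (interchange)
  open import Relation.Binary.Reasoning.Setoid setoid
  open IntegerCoefficients commutativeRing using (Polynomial; solve; _:+_; _:*_; _:-_; :-_; _:=_; con)

  -- Zero products and cancellation

  *-nonzero : ∀ {x y} → x ≉ 0# → y ≉ 0# → x * y ≉ 0#
  *-nonzero x≉0 y≉0 xy≈0 = x≉0 (split xy≈0 (λ y≈0 → contradiction y≈0 y≉0))

  -- With both factors equal, the implication that `split` asks for is the identity.
  square-zero : ∀ {x} → x * x ≈ 0# → x ≈ 0#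
  square-zero xx≈0 = split xx≈0 (λ x≈0 → x≈0)

  *-cancelˡ : ∀ a {x y} → a ≉ 0# → a * x ≈ a * y → x ≈ y
  *-cancelˡ a {x} {y} a≉0 ax≈ay = x∙y⁻¹≈ε⇒x≈y x y (split
    (begin
      (x - y) * a    ≈⟨ *-comm _ _ ⟩
      a * (x - y)    ≈⟨ x[y-z]≈xy-xz a x y ⟩
      a * x - a * y  ≈⟨ x≈y⇒x∙y⁻¹≈ε ax≈ay ⟩
      0#             ∎)
    (λ a≈0 → contradiction a≈0 a≉0))

  +-zeroˡ : ∀ {x y} → x ≈ 0# → x + y ≈ y
  +-zeroˡ x≈0 = trans (+-congʳ x≈0) (+-identityˡ _)

  +-zeroʳ : ∀ {x y} → y ≈ 0# → x + y ≈ x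
  +-zeroʳ y≈0 = trans (+-congˡ y≈0) (+-identityʳ _)

  *-zeroˡ : ∀ {x y} → x ≈ 0# → x * y ≈ 0#
  *-zeroˡ x≈0 = trans (*-congʳ x≈0) (zeroˡ _)

  *-zeroʳ : ∀ {x y} → y ≈ 0# → x * y ≈ 0#
  *-zeroʳ y≈0 = trans (*-congˡ y≈0) (zeroʳ _)

  -- The inner product and its definiteness

  infix 8 _∙_
  _∙_ : ∀ {d} → Vector Carrier d → Vector Carrier d → Carrier
  x ∙ y = sum (λ k → x k * y k)

  ∙-comm : ∀ {d} (x y : Vector Carrier d) → x ∙ y ≈ y ∙ x
  ∙-comm x y = sum-cong-≋ (λ k → *-comm (x k) (y k))

  ∙-nonNeg : ∀ {d} (x : Vector Carrier d) → NonNeg (x ∙ x)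
  ∙-nonNeg {zero}  x = 0-nonNeg
  ∙-nonNeg {suc d} x = +-nonNeg (square-nonNeg (x 0F)) (∙-nonNeg (tail x))

  ∙-definite : ∀ {d} (x : Vector Carrier d) → x ∙ x ≈ 0# → ∀ k → x k ≈ 0#
  ∙-definite {suc d} x xx≈0 = λ
    { 0F      → square-zero x₀x₀≈0
    ; (suc k) → ∙-definite (tail x) (trans (sym (+-zeroˡ x₀x₀≈0)) xx≈0) k
    }
    where
    x₀x₀≈0 : x 0F * x 0F ≈ 0#
    x₀x₀≈0 = summand-zero (square-nonNeg (x 0F)) (∙-nonNeg (tail x)) xx≈0

  -- Cross products and determinants in dimension three

  cross : Vector Carrier 3 → Vector Carrier 3 → Vector Carrier 3
  cross y z 0F = y 1F * z 2F - y 2F * z 1F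
  cross y z 1F = y 2F * z 0F - y 0F * z 2F
  cross y z 2F = y 0F * z 1F - y 1F * z 0F

  det : Vector Carrier 3 → Vector Carrier 3 → Vector Carrier 3 → Carrier
  det x y z = x ∙ cross y z

  private module _ {n : ℕ} where
    Triple : Set
    Triple = Polynomial n × Polynomial n × Polynomial n

    infix 9 _:∙_
    _:∙_ : Triple → Triple → Polynomial n
    -- The final zero mirrors the empty sum at which `sum` stops, so the expression evaluates
    -- exactly to `_∙_` in dimension three.
    (x₀ , x₁ , x₂) :∙ (y₀ , y₁ , y₂) = x₀ :* y₀ :+ (x₁ :* y₁ :+ (x₂ :* y₂ :+ con (+ 0)))

    :cross : Triple → Triple → Triple
    :cross (y₀ , y₁ , y₂) (z₀ , z₁ , z₂) =
      y₁ :* z₂ :- y₂ :* z₁ , y₂ :* z₀ :- y₀ :* z₂ , y₀ :* z₁ :- y₁ :* z₀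

    :det : Triple → Triple → Triple → Polynomial n
    :det x y z = x :∙ :cross y z

  -- Cramer's rule det(e,f,g) y = det(y,f,g) e + det(e,y,g) f + det(e,f,y) g, paired with x. As a
  -- polynomial identity it holds for all vectors, dependent or not.
  cramer : ∀ e f g x y → det e f g * x ∙ y ≈
           x ∙ e * det y f g + x ∙ f * det e y g + x ∙ g * det e f y
  cramer e f g x y = solve 15
    (λ e₀ e₁ e₂ f₀ f₁ f₂ g₀ g₁ g₂ x₀ x₁ x₂ y₀ y₁ y₂ →
      let e = e₀ , e₁ , e₂ ; f = f₀ , f₁ , f₂ ; g = g₀ , g₁ , g₂
          x = x₀ , x₁ , x₂ ; y = y₀ , y₁ , y₂
      in :det e f g :* x :∙ y :=
         x :∙ e :* :det y f g :+ x :∙ f :* :det e y g :+ x :∙ g :* :det e f y)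
    refl (e 0F) (e 1F) (e 2F) (f 0F) (f 1F) (f 2F) (g 0F) (g 1F) (g 2F)
         (x 0F) (x 1F) (x 2F) (y 0F) (y 1F) (y 2F)

  -- Lagrange's identity: the determinant on the left is the squared norm of the cross product of f
  -- and g.
  lagrange : ∀ f g → det (cross f g) f g + f ∙ g * f ∙ g ≈ f ∙ f * g ∙ g
  lagrange f g = solve 6
    (λ f₀ f₁ f₂ g₀ g₁ g₂ →
      let f = f₀ , f₁ , f₂ ; g = g₀ , g₁ , g₂
      in :det (:cross f g) f g :+ f :∙ g :* f :∙ g := f :∙ f :* g :∙ g)
    refl (f 0F) (f 1F) (f 2F) (g 0F) (g 1F) (g 2F)

  -- Coordinates with respect to an unnormalised orthogonal basis

  record OrthogonalBasis (e f g : Vector Carrier 3) : Set ℓ where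
    field
      e∙f≈0 : e ∙ f ≈ 0#
      e∙g≈0 : e ∙ g ≈ 0#
      f∙g≈0 : f ∙ g ≈ 0#
      e∙e≉0 : e ∙ e ≉ 0#
      f∙f≉0 : f ∙ f ≉ 0#
      g∙g≉0 : g ∙ g ≉ 0#

  module Parseval {e f g} (basis : OrthogonalBasis e f g) where
    open OrthogonalBasis basis

    -- Parseval's formula divides each term (x ∙ e)(y ∙ e) by the squared norm e ∙ e. Clearing the
    -- common denominator `Δ` leaves the weights `l`, `m`, `n`, each a product of the two other
    -- squared norms.
    l m n Δ : Carrier
    l = f ∙ f * g ∙ g
    m = e ∙ e * g ∙ g
    n = e ∙ e * f ∙ f
    Δ = e ∙ e * f ∙ f * g ∙ g

    -- Cramer's rule paired with e: orthogonality kills the terms in f and g. Thus each determinant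
    -- in `cramer` is a coordinate of y up to scale.
    det-e : ∀ y → det e f g * y ∙ e ≈ e ∙ e * det y f g
    det-e y = begin
      det e f g * y ∙ e  ≈⟨ *-congˡ (∙-comm y e) ⟩
      det e f g * e ∙ y  ≈⟨ cramer e f g e y ⟩
      e ∙ e * det y f g + e ∙ f * det e y g + e ∙ g * det e f y
        ≈⟨ trans (+-zeroʳ (*-zeroˡ e∙g≈0)) (+-zeroʳ (*-zeroˡ e∙f≈0)) ⟩
      e ∙ e * det y f g  ∎

    det-f : ∀ y → det e f g * y ∙ f ≈ f ∙ f * det e y g
    det-f y = begin
      det e f g * y ∙ f  ≈⟨ *-congˡ (∙-comm y f) ⟩
      det e f g * f ∙ y  ≈⟨ cramer e f g f y ⟩
      f ∙ e * det y f g + f ∙ f * det e y g + f ∙ g * det e f y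
        ≈⟨ trans (+-zeroʳ (*-zeroˡ f∙g≈0)) (+-zeroˡ (*-zeroˡ (trans (∙-comm f e) e∙f≈0))) ⟩
      f ∙ f * det e y g  ∎

    det-g : ∀ y → det e f g * y ∙ g ≈ g ∙ g * det e f y
    det-g y = begin
      det e f g * y ∙ g  ≈⟨ *-congˡ (∙-comm y g) ⟩
      det e f g * g ∙ y  ≈⟨ cramer e f g g y ⟩
      g ∙ e * det y f g + g ∙ f * det e y g + g ∙ g * det e f y
        ≈⟨ +-zeroˡ (trans (+-zeroʳ (*-zeroˡ (trans (∙-comm g f) f∙g≈0)))
                          (*-zeroˡ (trans (∙-comm g e) e∙g≈0))) ⟩
      g ∙ g * det e f y  ∎

    -- Applied to the cross product of f and g, `det-e` would make its squared norm zero, whereas by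
    -- `lagrange` and f ⊥ g that norm is the nonzero product of f ∙ f and g ∙ g.
    det≉0 : det e f g ≉ 0#
    det≉0 det≈0 = *-nonzero f∙f≉0 g∙g≉0 (begin
      f ∙ f * g ∙ g                          ≈⟨ lagrange f g ⟨
      det (cross f g) f g + f ∙ g * f ∙ g    ≈⟨ +-zeroʳ (*-zeroˡ f∙g≈0) ⟩
      det (cross f g) f g                    ≈⟨ *-cancelˡ (e ∙ e) e∙e≉0 (begin
        e ∙ e * det (cross f g) f g            ≈⟨ det-e (cross f g) ⟨
        det e f g * cross f g ∙ e              ≈⟨ *-zeroˡ det≈0 ⟩
        0#                                     ≈⟨ zeroʳ _ ⟨
        e ∙ e * 0#                             ∎) ⟩
      0#                                     ∎)

    -- Cramer's rule multiplied by `Δ`: each determinant receives the squared norm that turns it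
    -- into det(e,f,g) times a coordinate of y, and the nonzero determinant cancels.
    parseval : ∀ x y → Δ * x ∙ y ≈
               l * (x ∙ e * y ∙ e) + m * (x ∙ f * y ∙ f) + n * (x ∙ g * y ∙ g)
    parseval x y = *-cancelˡ (det e f g) det≉0 (begin
      D * (Δ * x ∙ y)
        ≈⟨ solve 5 (λ D A B C u → D :* (A :* B :* C :* u) := A :* B :* C :* (D :* u))
             refl D (e ∙ e) (f ∙ f) (g ∙ g) (x ∙ y) ⟩
      Δ * (D * x ∙ y)
        ≈⟨ *-congˡ (cramer e f g x y) ⟩
      Δ * (x ∙ e * det y f g + x ∙ f * det e y g + x ∙ g * det e f y)
        ≈⟨ solve 9 (λ A B C x₁ x₂ x₃ y₁ y₂ y₃ →
               A :* B :* C :* (x₁ :* y₁ :+ x₂ :* y₂ :+ x₃ :* y₃) :=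
               B :* C :* (x₁ :* (A :* y₁)) :+ A :* C :* (x₂ :* (B :* y₂))
                 :+ A :* B :* (x₃ :* (C :* y₃)))
             refl (e ∙ e) (f ∙ f) (g ∙ g) (x ∙ e) (x ∙ f) (x ∙ g)
             (det y f g) (det e y g) (det e f y) ⟩
      l * (x ∙ e * (e ∙ e * det y f g)) + m * (x ∙ f * (f ∙ f * det e y g))
        + n * (x ∙ g * (g ∙ g * det e f y))
        ≈⟨ +-cong (+-cong (*-congˡ (*-congˡ (det-e y))) (*-congˡ (*-congˡ (det-f y))))
             (*-congˡ (*-congˡ (det-g y))) ⟨
      l * (x ∙ e * (D * y ∙ e)) + m * (x ∙ f * (D * y ∙ f)) + n * (x ∙ g * (D * y ∙ g))
        ≈⟨ solve 10 (λ D l m n x₁ x₂ x₃ y₁ y₂ y₃ →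
               l :* (x₁ :* (D :* y₁)) :+ m :* (x₂ :* (D :* y₂)) :+ n :* (x₃ :* (D :* y₃)) :=
               D :* (l :* (x₁ :* y₁) :+ m :* (x₂ :* y₂) :+ n :* (x₃ :* y₃)))
             refl D l m n (x ∙ e) (x ∙ f) (x ∙ g) (y ∙ e) (y ∙ f) (y ∙ g) ⟩
      D * (l * (x ∙ e * y ∙ e) + m * (x ∙ f * y ∙ f) + n * (x ∙ g * y ∙ g))  ∎)
      where D = det e f g

    -- Only the f term of Parseval's formula survives. For the basis v₀₁, v₁, v₁₂ this is the
    -- relation that the orthogonality of the two corners imposes on v₀, v₁, v₂.
    through-f : ∀ x y → x ∙ e ≈ 0# → y ∙ g ≈ 0# → x ∙ y * f ∙ f ≈ x ∙ f * y ∙ f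
    through-f x y x∙e≈0 y∙g≈0 = *-cancelˡ m (*-nonzero e∙e≉0 g∙g≉0) (begin
      m * (x ∙ y * f ∙ f)
        ≈⟨ solve 4 (λ A B C u → A :* C :* (u :* B) := A :* B :* C :* u)
             refl (e ∙ e) (f ∙ f) (g ∙ g) (x ∙ y) ⟩
      Δ * x ∙ y
        ≈⟨ parseval x y ⟩
      l * (x ∙ e * y ∙ e) + m * (x ∙ f * y ∙ f) + n * (x ∙ g * y ∙ g)
        ≈⟨ +-zeroʳ (*-zeroʳ (*-zeroʳ y∙g≈0)) ⟩
      l * (x ∙ e * y ∙ e) + m * (x ∙ f * y ∙ f)
        ≈⟨ +-zeroˡ (*-zeroʳ (*-zeroˡ x∙e≈0)) ⟩
      m * (x ∙ f * y ∙ f)  ∎)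

    weighted-⊥ : ∀ x y → x ∙ y ≈ 0# →
      l * (x ∙ e * y ∙ e) + m * (x ∙ f * y ∙ f) + n * (x ∙ g * y ∙ g) ≈ 0#
    weighted-⊥ x y x∙y≈0 = trans (sym (parseval x y)) (*-zeroʳ x∙y≈0)

    weighted-⊥-e : ∀ x y → x ∙ e ≈ 0# → x ∙ y ≈ 0# →
      m * (x ∙ f * y ∙ f) + n * (x ∙ g * y ∙ g) ≈ 0#
    weighted-⊥-e x y x∙e≈0 x∙y≈0 =
      trans (+-congʳ (sym (+-zeroˡ (*-zeroʳ (*-zeroˡ x∙e≈0))))) (weighted-⊥ x y x∙y≈0)

    weighted-⊥-f : ∀ x y → x ∙ f ≈ 0# → x ∙ y ≈ 0# →
      l * (x ∙ e * y ∙ e) + n * (x ∙ g * y ∙ g) ≈ 0#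
    weighted-⊥-f x y x∙f≈0 x∙y≈0 =
      trans (+-congʳ (sym (+-zeroʳ (*-zeroʳ (*-zeroˡ x∙f≈0))))) (weighted-⊥ x y x∙y≈0)

    weighted-⊥-g : ∀ x y → y ∙ g ≈ 0# → x ∙ y ≈ 0# →
      l * (x ∙ e * y ∙ e) + m * (x ∙ f * y ∙ f) ≈ 0#
    weighted-⊥-g x y y∙g≈0 x∙y≈0 =
      trans (sym (+-zeroʳ (*-zeroʳ (*-zeroʳ y∙g≈0)))) (weighted-⊥ x y x∙y≈0)

    -- The relation of `through-f` rewritten in frame coordinates: both sides are multiplied by `Δ`
    -- twice, and each inner product is expanded by `parseval`.
    weighted-corner : ∀ x y z → x ∙ e ≈ 0# → z ∙ f ≈ 0# → x ∙ z * y ∙ y ≈ x ∙ y * z ∙ y →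
      n * (x ∙ g * z ∙ g) *
        (l * (y ∙ e * y ∙ e) + m * (y ∙ f * y ∙ f) + n * (y ∙ g * y ∙ g)) ≈
      (m * (x ∙ f * y ∙ f) + n * (x ∙ g * y ∙ g)) *
        (l * (y ∙ e * z ∙ e) + n * (y ∙ g * z ∙ g))
    weighted-corner x y z x∙e≈0 z∙f≈0 xz∙yy = begin
      n * (x ∙ g * z ∙ g) *
        (l * (y ∙ e * y ∙ e) + m * (y ∙ f * y ∙ f) + n * (y ∙ g * y ∙ g))
        ≈⟨ *-cong Δxz (parseval y y) ⟨
      Δ * x ∙ z * (Δ * y ∙ y)
        ≈⟨ interchange Δ (x ∙ z) Δ (y ∙ y) ⟩
      Δ * Δ * (x ∙ z * y ∙ y)
        ≈⟨ *-congˡ (trans xz∙yy (*-congˡ (∙-comm z y))) ⟩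
      Δ * Δ * (x ∙ y * y ∙ z)
        ≈⟨ interchange Δ Δ (x ∙ y) (y ∙ z) ⟩
      Δ * x ∙ y * (Δ * y ∙ z)
        ≈⟨ *-cong Δxy Δyz ⟩
      (m * (x ∙ f * y ∙ f) + n * (x ∙ g * y ∙ g)) *
        (l * (y ∙ e * z ∙ e) + n * (y ∙ g * z ∙ g))  ∎
      where
      Δxz : Δ * x ∙ z ≈ n * (x ∙ g * z ∙ g)
      Δxz = trans (parseval x z)
        (+-zeroˡ (trans (+-zeroʳ (*-zeroʳ (*-zeroʳ z∙f≈0))) (*-zeroʳ (*-zeroˡ x∙e≈0))))

      Δxy : Δ * x ∙ y ≈ m * (x ∙ f * y ∙ f) + n * (x ∙ g * y ∙ g)
      Δxy = trans (parseval x y) (+-congʳ (+-zeroˡ (*-zeroʳ (*-zeroˡ x∙e≈0))))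

      Δyz : Δ * y ∙ z ≈ l * (y ∙ e * z ∙ e) + n * (y ∙ g * z ∙ g)
      Δyz = trans (parseval y z) (+-congʳ (+-zeroʳ (*-zeroʳ (*-zeroʳ z∙f≈0))))

    -- Since z ⊥ g, the projections of x and y to the plane of e and f are both orthogonal to z. In
    -- a plane the vectors orthogonal to a nonzero vector form a line, so the projections are
    -- parallel.
    proportional : ∀ x y z → z ∙ g ≈ 0# → z ∙ f ≉ 0# → x ∙ z ≈ 0# → y ∙ z ≈ 0# →
      x ∙ e * y ∙ f ≈ x ∙ f * y ∙ e
    proportional x y z z∙g≈0 z∙f≉0 x∙z≈0 y∙z≈0 =
      *-cancelˡ (m * z ∙ f) (*-nonzero (*-nonzero e∙e≉0 g∙g≉0) z∙f≉0) (x∙y⁻¹≈ε⇒x≈y _ _ (begin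
        m * z ∙ f * (x ∙ e * y ∙ f) - m * z ∙ f * (x ∙ f * y ∙ e)
          ≈⟨ solve 8 (λ l m x₁ x₂ y₁ y₂ z₁ z₂ →
               m :* z₂ :* (x₁ :* y₂) :- m :* z₂ :* (x₂ :* y₁) :=
               x₁ :* (l :* (y₁ :* z₁) :+ m :* (y₂ :* z₂))
                 :- y₁ :* (l :* (x₁ :* z₁) :+ m :* (x₂ :* z₂)))
             refl l m (x ∙ e) (x ∙ f) (y ∙ e) (y ∙ f) (z ∙ e) (z ∙ f) ⟩
        x ∙ e * (l * (y ∙ e * z ∙ e) + m * (y ∙ f * z ∙ f))
          - y ∙ e * (l * (x ∙ e * z ∙ e) + m * (x ∙ f * z ∙ f))
          ≈⟨ +-cong (*-zeroʳ (weighted-⊥-g y z z∙g≈0 y∙z≈0))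
                    (-‿cong (*-zeroʳ (weighted-⊥-g x z z∙g≈0 x∙z≈0))) ⟩
        0# - 0#
          ≈⟨ -‿inverseʳ 0# ⟩
        0#  ∎))

  -- Polynomial elimination for v₀ = (0, y₀, z₀), v₁ = (x₁, y₁, z₁), v₂ = (x₂, 0, z₂)

  module Coordinates (l m n y₀ z₀ x₁ y₁ z₁ x₂ z₂ : Carrier) where

    -- The weighted squared norm of the projection of v₁ to the plane of a₁ and a₂.
    M : Carrier
    M = l * (x₁ * x₁) + m * (y₁ * y₁)

    -- M v₅ = z₅ (- n z₁ x₁ , - n z₁ y₁ , M), and similarly for v₄ and v₆.
    antipodal : ∀ y₄ z₄ x₅ y₅ z₅ x₆ z₆ →
      l ≉ 0# → m ≉ 0# → n ≉ 0# → z₁ ≉ 0# → z₄ ≉ 0# → z₅ ≉ 0# → z₆ ≉ 0# →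
      m * (y₀ * y₄) + n * (z₀ * z₄) ≈ 0# →
      l * (x₂ * x₆) + n * (z₂ * z₆) ≈ 0# →
      l * (x₁ * x₅) + m * (y₁ * y₅) + n * (z₁ * z₅) ≈ 0# →
      x₁ * y₅ ≈ y₁ * x₅ →
      n * (z₄ * z₆) * (l * (x₅ * x₅) + m * (y₅ * y₅) + n * (z₅ * z₅)) ≈
        (m * (y₄ * y₅) + n * (z₄ * z₅)) * (l * (x₅ * x₆) + n * (z₅ * z₆)) →
      z₁ * (n * z₀ * z₂ * x₁ * y₁) + M * (z₀ * y₁ * x₂ + y₀ * x₁ * z₂) ≈
        z₁ * (y₀ * x₂ * M)
    antipodal y₄ z₄ x₅ y₅ z₅ x₆ z₆ l≉0 m≉0 n≉0 z₁≉0 z₄≉0 z₅≉0 z₆≉0 v₀⊥v₄ v₂⊥v₆ v₁⊥v₅ v₁∥v₅ corner⊥ =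
      -- After scaling by n z₁ and adding y₀ x₂ M² to both sides, the left side factors. By `v₄∙v₅`
      -- and `v₅∙v₆` the two factors are, up to scale, the inner products of v₄, v₅ and of v₅, v₆.
      *-cancelˡ (n * z₁) (*-nonzero n≉0 z₁≉0) (+-cancelʳ (y₀ * x₂ * M * M) _ _ (begin
        n * z₁ * (z₁ * (n * z₀ * z₂ * x₁ * y₁) + M * (z₀ * y₁ * x₂ + y₀ * x₁ * z₂))
          + y₀ * x₂ * M * M
          ≈⟨ solve 9 (λ n y₀ z₀ x₁ y₁ z₁ x₂ z₂ M →
               n :* z₁ :* (z₁ :* (n :* z₀ :* z₂ :* x₁ :* y₁)
                 :+ M :* (z₀ :* y₁ :* x₂ :+ y₀ :* x₁ :* z₂)) :+ y₀ :* x₂ :* M :* M :=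
               (n :* z₀ :* z₁ :* y₁ :+ y₀ :* M) :* (n :* x₁ :* z₁ :* z₂ :+ x₂ :* M))
             refl n y₀ z₀ x₁ y₁ z₁ x₂ z₂ M ⟩
        (n * z₀ * z₁ * y₁ + y₀ * M) * (n * x₁ * z₁ * z₂ + x₂ * M)
          ≈⟨ *-cancelˡ q q≉0 scaled ⟩
        y₀ * x₂ * M * (n * (z₁ * z₁) + M)
          ≈⟨ solve 5 (λ n y₀ z₁ x₂ M →
               y₀ :* x₂ :* M :* (n :* (z₁ :* z₁) :+ M) :=
               n :* z₁ :* (z₁ :* (y₀ :* x₂ :* M)) :+ y₀ :* x₂ :* M :* M)
             refl n y₀ z₁ x₂ M ⟩
        n * z₁ * (z₁ * (y₀ * x₂ * M)) + y₀ * x₂ * M * M  ∎))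
      where
      q : Carrier
      -- The scalar shared by both sides once v₄, v₅, v₆ are expressed through v₀, v₁, v₂. It
      -- contains none of y₀, x₂, M, so cancelling it does not divide by these.
      q = n * n * m * l * (z₄ * z₆ * (z₅ * z₅))

      q≉0 : q ≉ 0#
      q≉0 = *-nonzero (*-nonzero (*-nonzero (*-nonzero n≉0 n≉0) m≉0) l≉0)
              (*-nonzero (*-nonzero z₄≉0 z₆≉0) (*-nonzero z₅≉0 z₅≉0))

      my₀y₄ : m * (y₀ * y₄) ≈ - (n * (z₀ * z₄))
      my₀y₄ = +-inverseˡ-unique _ _ v₀⊥v₄

      lx₂x₆ : l * (x₂ * x₆) ≈ - (n * (z₂ * z₆))
      lx₂x₆ = +-inverseˡ-unique _ _ v₂⊥v₆

      -- Because x₁ y₅ = y₁ x₅, the product x₁ (l x₁ x₅ + m y₁ y₅) equals M x₅; hence x₁ times the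
      -- equation v₁ ⊥ v₅ gives the claim. `My₅` uses y₁ in the same way.
      Mx₅ : M * x₅ ≈ - (n * (x₁ * (z₁ * z₅)))
      Mx₅ = +-inverseˡ-unique _ _ (begin
        M * x₅ + n * (x₁ * (z₁ * z₅))
          ≈⟨ solve 9 (λ l m n x₁ y₁ z₁ x₅ y₅ z₅ →
               (l :* (x₁ :* x₁) :+ m :* (y₁ :* y₁)) :* x₅ :+ n :* (x₁ :* (z₁ :* z₅)) :=
               x₁ :* (l :* (x₁ :* x₅) :+ m :* (y₁ :* y₅) :+ n :* (z₁ :* z₅))
                 :- m :* y₁ :* (x₁ :* y₅ :- y₁ :* x₅))
             refl l m n x₁ y₁ z₁ x₅ y₅ z₅ ⟩
        x₁ * (l * (x₁ * x₅) + m * (y₁ * y₅) + n * (z₁ * z₅)) - m * y₁ * (x₁ * y₅ - y₁ * x₅)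
          ≈⟨ +-cong (*-zeroʳ v₁⊥v₅) (-‿cong (*-zeroʳ (x≈y⇒x∙y⁻¹≈ε v₁∥v₅))) ⟩
        0# - 0#
          ≈⟨ -‿inverseʳ 0# ⟩
        0#  ∎)

      My₅ : M * y₅ ≈ - (n * (y₁ * (z₁ * z₅)))
      My₅ = +-inverseˡ-unique _ _ (begin
        M * y₅ + n * (y₁ * (z₁ * z₅))
          ≈⟨ solve 9 (λ l m n x₁ y₁ z₁ x₅ y₅ z₅ →
               (l :* (x₁ :* x₁) :+ m :* (y₁ :* y₁)) :* y₅ :+ n :* (y₁ :* (z₁ :* z₅)) :=
               y₁ :* (l :* (x₁ :* x₅) :+ m :* (y₁ :* y₅) :+ n :* (z₁ :* z₅))
                 :+ l :* x₁ :* (x₁ :* y₅ :- y₁ :* x₅))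
             refl l m n x₁ y₁ z₁ x₅ y₅ z₅ ⟩
        y₁ * (l * (x₁ * x₅) + m * (y₁ * y₅) + n * (z₁ * z₅)) + l * x₁ * (x₁ * y₅ - y₁ * x₅)
          ≈⟨ +-cong (*-zeroʳ v₁⊥v₅) (*-zeroʳ (x≈y⇒x∙y⁻¹≈ε v₁∥v₅)) ⟩
        0# + 0#
          ≈⟨ +-identityʳ 0# ⟩
        0#  ∎)

      -- The factors y₀ and M make y₄ and y₅ occur only through m y₀ y₄ and M y₅, both of which are
      -- known. `v₅∙v₆` does the same with x₂ and M.
      v₄∙v₅ : m * y₀ * M * (m * (y₄ * y₅) + n * (z₄ * z₅)) ≈
              n * m * (z₄ * z₅) * (n * z₀ * z₁ * y₁ + y₀ * M)
      v₄∙v₅ = begin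
        m * y₀ * M * (m * (y₄ * y₅) + n * (z₄ * z₅))
          ≈⟨ solve 8 (λ m n M y₀ y₄ y₅ z₄ z₅ →
               m :* y₀ :* M :* (m :* (y₄ :* y₅) :+ n :* (z₄ :* z₅)) :=
               m :* (m :* (y₀ :* y₄) :* (M :* y₅)) :+ n :* m :* (z₄ :* z₅) :* (y₀ :* M))
             refl m n M y₀ y₄ y₅ z₄ z₅ ⟩
        m * (m * (y₀ * y₄) * (M * y₅)) + n * m * (z₄ * z₅) * (y₀ * M)
          ≈⟨ +-congʳ (*-congˡ (*-cong my₀y₄ My₅)) ⟩
        m * (- (n * (z₀ * z₄)) * - (n * (y₁ * (z₁ * z₅)))) + n * m * (z₄ * z₅) * (y₀ * M)
          ≈⟨ solve 9 (λ m n M y₀ z₀ y₁ z₁ z₄ z₅ →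
               m :* (:- (n :* (z₀ :* z₄)) :* :- (n :* (y₁ :* (z₁ :* z₅))))
                 :+ n :* m :* (z₄ :* z₅) :* (y₀ :* M) :=
               n :* m :* (z₄ :* z₅) :* (n :* z₀ :* z₁ :* y₁ :+ y₀ :* M))
             refl m n M y₀ z₀ y₁ z₁ z₄ z₅ ⟩
        n * m * (z₄ * z₅) * (n * z₀ * z₁ * y₁ + y₀ * M)  ∎

      v₅∙v₆ : l * x₂ * M * (l * (x₅ * x₆) + n * (z₅ * z₆)) ≈
              n * l * (z₅ * z₆) * (n * x₁ * z₁ * z₂ + x₂ * M)
      v₅∙v₆ = begin
        l * x₂ * M * (l * (x₅ * x₆) + n * (z₅ * z₆))
          ≈⟨ solve 8 (λ l n M x₂ x₅ z₅ x₆ z₆ →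
               l :* x₂ :* M :* (l :* (x₅ :* x₆) :+ n :* (z₅ :* z₆)) :=
               l :* (l :* (x₂ :* x₆) :* (M :* x₅)) :+ n :* l :* (z₅ :* z₆) :* (x₂ :* M))
             refl l n M x₂ x₅ z₅ x₆ z₆ ⟩
        l * (l * (x₂ * x₆) * (M * x₅)) + n * l * (z₅ * z₆) * (x₂ * M)
          ≈⟨ +-congʳ (*-congˡ (*-cong lx₂x₆ Mx₅)) ⟩
        l * (- (n * (z₂ * z₆)) * - (n * (x₁ * (z₁ * z₅)))) + n * l * (z₅ * z₆) * (x₂ * M)
          ≈⟨ solve 9 (λ l n M x₁ z₁ x₂ z₂ z₅ z₆ →
               l :* (:- (n :* (z₂ :* z₆)) :* :- (n :* (x₁ :* (z₁ :* z₅))))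
                 :+ n :* l :* (z₅ :* z₆) :* (x₂ :* M) :=
               n :* l :* (z₅ :* z₆) :* (n :* x₁ :* z₁ :* z₂ :+ x₂ :* M))
             refl l n M x₁ z₁ x₂ z₂ z₅ z₆ ⟩
        n * l * (z₅ * z₆) * (n * x₁ * z₁ * z₂ + x₂ * M)  ∎

      v₅∙v₅ : M * M * (l * (x₅ * x₅) + m * (y₅ * y₅) + n * (z₅ * z₅)) ≈
              n * (z₅ * z₅) * (M * (n * (z₁ * z₁) + M))
      v₅∙v₅ = begin
        M * M * (l * (x₅ * x₅) + m * (y₅ * y₅) + n * (z₅ * z₅))
          ≈⟨ solve 7 (λ l m n M x₅ y₅ z₅ →
               M :* M :* (l :* (x₅ :* x₅) :+ m :* (y₅ :* y₅) :+ n :* (z₅ :* z₅)) :=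
               l :* (M :* x₅ :* (M :* x₅)) :+ m :* (M :* y₅ :* (M :* y₅))
                 :+ n :* (M :* z₅ :* (M :* z₅)))
             refl l m n M x₅ y₅ z₅ ⟩
        l * (M * x₅ * (M * x₅)) + m * (M * y₅ * (M * y₅)) + n * (M * z₅ * (M * z₅))
          ≈⟨ +-congʳ (+-cong (*-congˡ (*-cong Mx₅ Mx₅)) (*-congˡ (*-cong My₅ My₅))) ⟩
        l * (- (n * (x₁ * (z₁ * z₅))) * - (n * (x₁ * (z₁ * z₅))))
          + m * (- (n * (y₁ * (z₁ * z₅))) * - (n * (y₁ * (z₁ * z₅)))) + n * (M * z₅ * (M * z₅))
          ≈⟨ solve 7 (λ l m n x₁ y₁ z₁ z₅ →
               let M = l :* (x₁ :* x₁) :+ m :* (y₁ :* y₁)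
                   x = :- (n :* (x₁ :* (z₁ :* z₅)))
                   y = :- (n :* (y₁ :* (z₁ :* z₅)))
               in l :* (x :* x) :+ m :* (y :* y) :+ n :* (M :* z₅ :* (M :* z₅)) :=
                  n :* (z₅ :* z₅) :* (M :* (n :* (z₁ :* z₁) :+ M)))
             refl l m n x₁ y₁ z₁ z₅ ⟩
        n * (z₅ * z₅) * (M * (n * (z₁ * z₁) + M))  ∎

      scaled : q * ((n * z₀ * z₁ * y₁ + y₀ * M) * (n * x₁ * z₁ * z₂ + x₂ * M)) ≈
               q * (y₀ * x₂ * M * (n * (z₁ * z₁) + M))
      scaled = begin
        q * (U * V)
          ≈⟨ solve 8 (λ l m n z₄ z₅ z₆ U V →
               n :* n :* m :* l :* (z₄ :* z₆ :* (z₅ :* z₅)) :* (U :* V) :=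
               n :* m :* (z₄ :* z₅) :* U :* (n :* l :* (z₅ :* z₆) :* V))
             refl l m n z₄ z₅ z₆ U V ⟩
        n * m * (z₄ * z₅) * U * (n * l * (z₅ * z₆) * V)
          ≈⟨ *-cong v₄∙v₅ v₅∙v₆ ⟨
        m * y₀ * M * G * (l * x₂ * M * H)
          ≈⟨ solve 7 (λ l m M y₀ x₂ G H →
               m :* y₀ :* M :* G :* (l :* x₂ :* M :* H) :=
               m :* y₀ :* (l :* x₂) :* (M :* M) :* (G :* H))
             refl l m M y₀ x₂ G H ⟩
        m * y₀ * (l * x₂) * (M * M) * (G * H)
          -- The corner relation at v₅ replaces the product of the two inner products by z₄ z₆ times
          -- the weighted squared norm of v₅.
          ≈⟨ *-congˡ corner⊥ ⟨
        m * y₀ * (l * x₂) * (M * M) * (n * (z₄ * z₆) * L)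
          ≈⟨ solve 9 (λ l m n M y₀ x₂ z₄ z₆ L →
               m :* y₀ :* (l :* x₂) :* (M :* M) :* (n :* (z₄ :* z₆) :* L) :=
               m :* y₀ :* (l :* x₂) :* (n :* (z₄ :* z₆)) :* (M :* M :* L))
             refl l m n M y₀ x₂ z₄ z₆ L ⟩
        m * y₀ * (l * x₂) * (n * (z₄ * z₆)) * (M * M * L)
          ≈⟨ *-congˡ v₅∙v₅ ⟩
        m * y₀ * (l * x₂) * (n * (z₄ * z₆)) * (n * (z₅ * z₅) * (M * (n * (z₁ * z₁) + M)))
          ≈⟨ solve 10 (λ l m n M y₀ z₁ x₂ z₄ z₅ z₆ →
               m :* y₀ :* (l :* x₂) :* (n :* (z₄ :* z₆))
                 :* (n :* (z₅ :* z₅) :* (M :* (n :* (z₁ :* z₁) :+ M))) :=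
               n :* n :* m :* l :* (z₄ :* z₆ :* (z₅ :* z₅))
                 :* (y₀ :* x₂ :* M :* (n :* (z₁ :* z₁) :+ M)))
             refl l m n M y₀ z₁ x₂ z₄ z₅ z₆ ⟩
        q * (y₀ * x₂ * M * (n * (z₁ * z₁) + M))  ∎
        where
        U V G H L : Carrier
        U = n * z₀ * z₁ * y₁ + y₀ * M
        V = n * x₁ * z₁ * z₂ + x₂ * M
        G = m * (y₄ * y₅) + n * (z₄ * z₅)
        H = l * (x₅ * x₆) + n * (z₅ * z₆)
        L = l * (x₅ * x₅) + m * (y₅ * y₅) + n * (z₅ * z₅)

    -- The hypotheses read N = P + z₁ G and z₁ T + H = z₁ S, whence
    -- (N - P) (S - T) = G H; x₁ y₁ divides the difference of the two sides.
    eliminated : x₁ ≉ 0# → y₁ ≉ 0# →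
      n * (z₀ * z₂) * (l * (x₁ * x₁) + m * (y₁ * y₁) + n * (z₁ * z₁)) ≈
        (m * (y₀ * y₁) + n * (z₀ * z₁)) * (l * (x₁ * x₂) + n * (z₁ * z₂)) →
      z₁ * (n * z₀ * z₂ * x₁ * y₁) + M * (z₀ * y₁ * x₂ + y₀ * x₁ * z₂) ≈
        z₁ * (y₀ * x₂ * M) →
      l * m * n * (x₁ * y₀ * z₂ * (y₁ * z₀ * x₂)) ≈
        M * (m * (y₀ * y₀) + n * (z₀ * z₀)) * (l * (x₂ * x₂) + n * (z₂ * z₂))
    eliminated x₁≉0 y₁≉0 corner⊥ antipodal = *-cancelˡ (x₁ * y₁) (*-nonzero x₁≉0 y₁≉0)
      (x∙y⁻¹≈ε⇒x≈y _ _ (begin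
        x₁ * y₁ * (l * m * n * (x₁ * y₀ * z₂ * (y₁ * z₀ * x₂)))
          - x₁ * y₁ * (M * (m * (y₀ * y₀) + n * (z₀ * z₀)) * (l * (x₂ * x₂) + n * (z₂ * z₂)))
          ≈⟨ solve 9 (λ l m n y₀ z₀ x₁ y₁ x₂ z₂ →
               let M = l :* (x₁ :* x₁) :+ m :* (y₁ :* y₁)
                   N = n :* z₀ :* z₂ :* M
                   P = l :* m :* x₁ :* y₁ :* y₀ :* x₂
                   G = n :* (m :* y₀ :* y₁ :* z₂ :+ l :* x₁ :* x₂ :* z₀)
                   S = y₀ :* x₂ :* M
                   T = n :* z₀ :* z₂ :* x₁ :* y₁
                   H = M :* (z₀ :* y₁ :* x₂ :+ y₀ :* x₁ :* z₂)
               in x₁ :* y₁ :* (l :* m :* n :* (x₁ :* y₀ :* z₂ :* (y₁ :* z₀ :* x₂)))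
                    :- x₁ :* y₁ :* (M :* (m :* (y₀ :* y₀) :+ n :* (z₀ :* z₀))
                                      :* (l :* (x₂ :* x₂) :+ n :* (z₂ :* z₂))) :=
                  (N :- P) :* (S :- T) :- G :* H)
             refl l m n y₀ z₀ x₁ y₁ x₂ z₂ ⟩
        (N - P) * (S - T) - G * H
          -- The terms z₁ G (S - T) cancel, so the expression is a combination of the two
          -- hypotheses, each written as a difference.
          ≈⟨ solve 7 (λ N P G S T H z →
               (N :- P) :* (S :- T) :- G :* H :=
               (S :- T) :* (N :- (P :+ z :* G)) :+ G :* (z :* S :- (z :* T :+ H)))
             refl N P G S T H z₁ ⟩
        (S - T) * (N - (P + z₁ * G)) + G * (z₁ * S - (z₁ * T + H))
          ≈⟨ +-cong (*-zeroʳ (x≈y⇒x∙y⁻¹≈ε N≈P+zG))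
                    (*-zeroʳ (x≈y⇒x∙y⁻¹≈ε (sym antipodal))) ⟩
        0# + 0#
          ≈⟨ +-identityʳ 0# ⟩
        0#  ∎))
      where
      N P G S T H : Carrier
      N = n * z₀ * z₂ * M
      P = l * m * x₁ * y₁ * y₀ * x₂
      G = n * (m * y₀ * y₁ * z₂ + l * x₁ * x₂ * z₀)
      S = y₀ * x₂ * M
      T = n * z₀ * z₂ * x₁ * y₁
      H = M * (z₀ * y₁ * x₂ + y₀ * x₁ * z₂)

      N≈P+zG : N ≈ P + z₁ * G
      -- Both sides of the corner relation contain n² z₀ z₂ z₁²; removing it leaves an equation
      -- linear in z₁.
      N≈P+zG = +-cancelʳ (n * n * (z₀ * z₂) * (z₁ * z₁)) _ _ (begin
        N + n * n * (z₀ * z₂) * (z₁ * z₁)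
          ≈⟨ solve 8 (λ l m n x₁ y₁ z₁ z₀ z₂ →
               n :* z₀ :* z₂ :* (l :* (x₁ :* x₁) :+ m :* (y₁ :* y₁))
                 :+ n :* n :* (z₀ :* z₂) :* (z₁ :* z₁) :=
               n :* (z₀ :* z₂) :* (l :* (x₁ :* x₁) :+ m :* (y₁ :* y₁) :+ n :* (z₁ :* z₁)))
             refl l m n x₁ y₁ z₁ z₀ z₂ ⟩
        n * (z₀ * z₂) * (l * (x₁ * x₁) + m * (y₁ * y₁) + n * (z₁ * z₁))
          ≈⟨ corner⊥ ⟩
        (m * (y₀ * y₁) + n * (z₀ * z₁)) * (l * (x₁ * x₂) + n * (z₁ * z₂))
          ≈⟨ solve 10 (λ l m n y₀ z₀ x₁ y₁ z₁ x₂ z₂ →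
               (m :* (y₀ :* y₁) :+ n :* (z₀ :* z₁)) :* (l :* (x₁ :* x₂) :+ n :* (z₁ :* z₂)) :=
               l :* m :* x₁ :* y₁ :* y₀ :* x₂
                 :+ z₁ :* (n :* (m :* y₀ :* y₁ :* z₂ :+ l :* x₁ :* x₂ :* z₀))
                 :+ n :* n :* (z₀ :* z₂) :* (z₁ :* z₁))
             refl l m n y₀ z₀ x₁ y₁ z₁ x₂ z₂ ⟩
        P + z₁ * G + n * n * (z₀ * z₂) * (z₁ * z₁)  ∎)

    -- Twice the difference of the two sides is l m n u² plus nonnegative terms,
    -- among them l m n (v² + (u - v)²).
    positive : NonNeg l → NonNeg m → NonNeg n →
      l ≉ 0# → m ≉ 0# → n ≉ 0# → x₁ ≉ 0# → y₀ ≉ 0# → z₂ ≉ 0# →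
      l * m * n * (x₁ * y₀ * z₂ * (y₁ * z₀ * x₂)) ≉
        M * (m * (y₀ * y₀) + n * (z₀ * z₀)) * (l * (x₂ * x₂) + n * (z₂ * z₂))
    positive l≥0 m≥0 n≥0 l≉0 m≉0 n≉0 x₁≉0 y₀≉0 z₂≉0 uv≈ =
      *-nonzero (*-nonzero (*-nonzero l≉0 m≉0) n≉0) (*-nonzero u≉0 u≉0)
        (summand-zero (*-nonNeg lmn≥0 (square-nonNeg u)) rest≥0 (begin
          l * m * n * (u * u) + (l * m * n * (v * v) + l * m * n * ((u - v) * (u - v)) + (r + r))
            ≈⟨ solve 9 (λ l m n y₀ z₀ x₁ y₁ x₂ z₂ →
                 let M = l :* (x₁ :* x₁) :+ m :* (y₁ :* y₁)
                     u = x₁ :* y₀ :* z₂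
                     v = y₁ :* z₀ :* x₂
                     _² = λ x → x :* x
                     r = l :* (x₁ ²) :* (m :* (y₀ ²)) :* (l :* (x₂ ²))
                       :+ l :* (x₁ ²) :* (n :* (z₀ ²)) :* (l :* (x₂ ²) :+ n :* (z₂ ²))
                       :+ m :* (y₁ ²) :* (m :* (y₀ ²)) :* (l :* (x₂ ²) :+ n :* (z₂ ²))
                       :+ m :* (y₁ ²) :* (n :* (z₀ ²)) :* (n :* (z₂ ²))
                     w = M :* (m :* (y₀ :* y₀) :+ n :* (z₀ :* z₀))
                           :* (l :* (x₂ :* x₂) :+ n :* (z₂ :* z₂))
                           :- l :* m :* n :* (u :* v)
                 in l :* m :* n :* (u :* u)
                      :+ (l :* m :* n :* (v :* v) :+ l :* m :* n :* ((u :- v) :* (u :- v)) :+ (r :+ r))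
                    := w :+ w)
               refl l m n y₀ z₀ x₁ y₁ x₂ z₂ ⟩
          w + w
            ≈⟨ trans (+-zeroˡ w≈0) w≈0 ⟩
          0#  ∎))
      where
      _² : Carrier → Carrier
      x ² = x * x

      -- The right side of the inequality expands into eight monomials: l m n u², l m n v² and six
      -- others, which `r` collects. `w` is the right side minus the left side.
      u v r w : Carrier
      u = x₁ * y₀ * z₂
      v = y₁ * z₀ * x₂
      r = l * (x₁ ²) * (m * (y₀ ²)) * (l * (x₂ ²))
        + l * (x₁ ²) * (n * (z₀ ²)) * (l * (x₂ ²) + n * (z₂ ²))
        + m * (y₁ ²) * (m * (y₀ ²)) * (l * (x₂ ²) + n * (z₂ ²))
        + m * (y₁ ²) * (n * (z₀ ²)) * (n * (z₂ ²))
      w = M * (m * (y₀ * y₀) + n * (z₀ * z₀)) * (l * (x₂ * x₂) + n * (z₂ * z₂))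
          - l * m * n * (u * v)

      w≈0 : w ≈ 0#
      w≈0 = x≈y⇒x∙y⁻¹≈ε (sym uv≈)

      u≉0 : u ≉ 0#
      u≉0 = *-nonzero (*-nonzero x₁≉0 y₀≉0) z₂≉0

      lmn≥0 : NonNeg (l * m * n)
      lmn≥0 = *-nonNeg (*-nonNeg l≥0 m≥0) n≥0

      l² : ∀ x → NonNeg (l * x ²)
      l² x = *-nonNeg l≥0 (square-nonNeg x)
      m² : ∀ x → NonNeg (m * x ²)
      m² x = *-nonNeg m≥0 (square-nonNeg x)
      n² : ∀ x → NonNeg (n * x ²)
      n² x = *-nonNeg n≥0 (square-nonNeg x)

      N₂≥0 : NonNeg (l * (x₂ ²) + n * (z₂ ²))
      N₂≥0 = +-nonNeg (l² x₂) (n² z₂)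

      r≥0 : NonNeg r
      r≥0 = +-nonNeg (+-nonNeg (+-nonNeg
        (*-nonNeg (*-nonNeg (l² x₁) (m² y₀)) (l² x₂))
        (*-nonNeg (*-nonNeg (l² x₁) (n² z₀)) N₂≥0))
        (*-nonNeg (*-nonNeg (m² y₁) (m² y₀)) N₂≥0))
        (*-nonNeg (*-nonNeg (m² y₁) (n² z₀)) (n² z₂))

      rest≥0 : NonNeg (l * m * n * (v * v) + l * m * n * ((u - v) * (u - v)) + (r + r))
      rest≥0 = +-nonNeg
        (+-nonNeg (*-nonNeg lmn≥0 (square-nonNeg v)) (*-nonNeg lmn≥0 (square-nonNeg (u - v))))
        (+-nonNeg r≥0 r≥0)

  -- Application to the vectors of a representation

  module _ (v : Vertex₂₁ → Vector Carrier 3)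
    (nonzero : ∀ s → ¬ (∀ k → v s k ≈ 0#))
    (orthogonal : ∀ {s t} → s ≢ t → (v s ∙ v t ≈ 0#) ⇔ ShareHyperedge s t)
    where

    ∙-nonzero : ∀ {s t} → s ≢ t → ¬ MayShare s t → v s ∙ v t ≉ 0#
    ∙-nonzero s≢t ¬share s∙t≈0 =
      ¬share (shareHyperedge⇒mayShare (Equivalence.to (orthogonal s≢t) s∙t≈0))

    norm-nonzero : ∀ s → v s ∙ v s ≉ 0#
    norm-nonzero s s∙s≈0 = nonzero s (∙-definite (v s) s∙s≈0)

    -- Orthogonality is only granted for distinct vertices; `uniform` supplies the distinctness
    -- within a hyperedge.
    hyperedge-basis : ∀ {s t u} → Hyperedge₂₁ (s Vec.∷ t Vec.∷ u Vec.∷ Vec.[]) →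
                      OrthogonalBasis (v s) (v t) (v u)
    hyperedge-basis {s} {t} {u} h with uniform h
    ... | (s≢t ∷ s≢u ∷ []) ∷ (t≢u ∷ []) ∷ _ = record
      { e∙f≈0 = Equivalence.from (orthogonal s≢t)
                  (_ , h , here ≡.refl , there (here ≡.refl))
      ; e∙g≈0 = Equivalence.from (orthogonal s≢u)
                  (_ , h , here ≡.refl , there (there (here ≡.refl)))
      ; f∙g≈0 = Equivalence.from (orthogonal t≢u)
                  (_ , h , there (here ≡.refl) , there (there (here ≡.refl)))
      ; e∙e≉0 = norm-nonzero s
      ; f∙f≉0 = norm-nonzero t
      ; g∙g≉0 = norm-nonzero u
      }

    module _ {s t u} (h : Hyperedge₂₁ (s Vec.∷ t Vec.∷ u Vec.∷ Vec.[])) where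
      open OrthogonalBasis (hyperedge-basis h)

      ⊥₁₂ : v s ∙ v t ≈ 0#
      ⊥₁₂ = e∙f≈0

      ⊥₁₃ : v s ∙ v u ≈ 0#
      ⊥₁₃ = e∙g≈0

      ⊥₂₃ : v t ∙ v u ≈ 0#
      ⊥₂₃ = f∙g≈0

      ⊥₂₁ : v t ∙ v s ≈ 0#
      ⊥₂₁ = trans (∙-comm (v t) (v s)) ⊥₁₂

      ⊥₃₂ : v u ∙ v t ≈ 0#
      ⊥₃₂ = trans (∙-comm (v u) (v t)) ⊥₂₃

    -- The hyperedge `Fa` lists c in the middle; here c comes last, so that it carries the third
    -- coordinate and the weight `n`.
    frame : OrthogonalBasis (v a₁) (v a₂) (v c)
    frame = record
      { e∙f≈0 = ⊥₁₃ Fa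
      ; e∙g≈0 = ⊥₁₂ Fa
      ; f∙g≈0 = ⊥₃₂ Fa
      ; e∙e≉0 = norm-nonzero a₁
      ; f∙f≉0 = norm-nonzero a₂
      ; g∙g≉0 = norm-nonzero c
      }

    open Parseval frame

    x y z : Fin 8 → Carrier
    x j = v (mid j) ∙ v a₁
    y j = v (mid j) ∙ v a₂
    z j = v (mid j) ∙ v c

    z≉0 : ∀ j → z j ≉ 0#
    z≉0 j = ∙-nonzero {mid j} {c} (λ ()) (λ ())

    l≉0 : l ≉ 0#
    l≉0 = *-nonzero (norm-nonzero a₂) (norm-nonzero c)

    m≉0 : m ≉ 0#
    m≉0 = *-nonzero (norm-nonzero a₁) (norm-nonzero c)

    n≉0 : n ≉ 0#
    n≉0 = *-nonzero (norm-nonzero a₁) (norm-nonzero a₂)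

    x₁≉0 : x 1F ≉ 0#
    x₁≉0 = ∙-nonzero {mid 1F} {a₁} (λ ()) (λ ())

    -- In the basis v₀₁, v₁, v₁₂ of `E 1F`, the hyperedge `E 0F` gives v₀ ⊥ v₀₁ and `E 2F` gives v₂
    -- ⊥ v₁₂.
    corner₁ : v (mid 0F) ∙ v (mid 2F) * v (mid 1F) ∙ v (mid 1F) ≈
              v (mid 0F) ∙ v (mid 1F) * v (mid 2F) ∙ v (mid 1F)
    corner₁ = Parseval.through-f (hyperedge-basis (E 1F)) (v (mid 0F)) (v (mid 2F))
                (⊥₂₃ (E 0F)) (⊥₂₁ (E 2F))

    corner₅ : v (mid 4F) ∙ v (mid 6F) * v (mid 5F) ∙ v (mid 5F) ≈
              v (mid 4F) ∙ v (mid 5F) * v (mid 6F) ∙ v (mid 5F)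
    corner₅ = Parseval.through-f (hyperedge-basis (E 5F)) (v (mid 4F)) (v (mid 6F))
                (⊥₂₃ (E 4F)) (⊥₂₁ (E 6F))

    open Coordinates l m n (y 0F) (z 0F) (x 1F) (y 1F) (z 1F) (x 2F) (z 2F)

    no-representation : ⊥
    no-representation =
      positive (*-nonNeg (∙-nonNeg (v a₂)) (∙-nonNeg (v c)))
               (*-nonNeg (∙-nonNeg (v a₁)) (∙-nonNeg (v c)))
               (*-nonNeg (∙-nonNeg (v a₁)) (∙-nonNeg (v a₂)))
               l≉0 m≉0 n≉0 x₁≉0 (∙-nonzero {mid 0F} {a₂} (λ ()) (λ ())) (z≉0 2F)
        (eliminated x₁≉0 (∙-nonzero {mid 1F} {a₂} (λ ()) (λ ()))
          (weighted-corner (v (mid 0F)) (v (mid 1F)) (v (mid 2F)) (⊥₁₂ D₀) (⊥₁₂ D₂) corner₁)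
          (antipodal (y 4F) (z 4F) (x 5F) (y 5F) (z 5F) (x 6F) (z 6F)
            l≉0 m≉0 n≉0 (z≉0 1F) (z≉0 4F) (z≉0 5F) (z≉0 6F)
            (weighted-⊥-e (v (mid 0F)) (v (mid 4F)) (⊥₁₂ D₀) (⊥₁₃ D₀))
            (weighted-⊥-f (v (mid 2F)) (v (mid 6F)) (⊥₁₂ D₂) (⊥₁₃ D₂))
            (weighted-⊥ (v (mid 1F)) (v (mid 5F)) (⊥₁₃ D₁))
            -- By `D₁` both v₁ and v₅ are orthogonal to b₂, which by `Fb` lies in the plane of a₁
            -- and a₂.
            (proportional (v (mid 1F)) (v (mid 5F)) (v b₂)
              (⊥₃₂ Fb) (∙-nonzero {b₂} {a₂} (λ ()) (λ ())) (⊥₁₂ D₁) (⊥₃₂ D₁))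
            (weighted-corner (v (mid 4F)) (v (mid 5F)) (v (mid 6F)) (⊥₃₂ D₀) (⊥₃₂ D₂) corner₅)))

-- Identities for differences in a commutative ring

module Differences {a ℓ} (R : CommutativeRing a ℓ) where
  open CommutativeRing R
  open IntegerCoefficients R using (solve; _:+_; _:*_; _:-_; :-_; _:=_)

  difference+ : ∀ p q → p ≈ (p - q) + q
  difference+ = solve 2 (λ p q → p := (p :- q) :+ q) refl

  cancel-double : ∀ p → p ≈ - p + (p + p)
  cancel-double = solve 1 (λ p → p := :- p :+ (p :+ p)) refl

  cancel-neg : ∀ p q → - p + (p + q) ≈ q
  cancel-neg = solve 2 (λ p q → :- p :+ (p :+ q) := q) refl

  neg-difference : ∀ p q → - (p - q) ≈ q - p
  neg-difference = solve 2 (λ p q → :- (p :- q) := q :- p) refl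

  telescope : ∀ p q r → (p - q) + (q - r) ≈ p - r
  telescope = solve 3 (λ p q r → (p :- q) :+ (q :- r) := p :- r) refl

  +-difference : ∀ p q r s → (p - q) + (r - s) ≈ (p + r) - (q + s)
  +-difference = solve 4 (λ p q r s → (p :- q) :+ (r :- s) := (p :+ r) :- (q :+ s)) refl

  *-difference : ∀ p q r s → p * (r - s) + s * (p - q) ≈ p * r - q * s
  *-difference = solve 4 (λ p q r s → p :* (r :- s) :+ s :* (p :- q) := p :* r :- q :* s) refl

-- Null sequences of rationals

open Product using (_×_)
open Defs
open Differences ℚ.+-*-commutativeRing

private
  half-positive : ∀ {ε} → 0ℚ ℚ.< ε → 0ℚ ℚ.< ½ ℚ.* ε
  half-positive {ε} 0<ε = ℚ.positive⁻¹ (½ ℚ.* ε) {{ℚ.pos*pos⇒pos ½ ε {{ℚ.positive 0<ε}}}}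

  half+half : ∀ ε → ½ ℚ.* ε ℚ.+ ½ ℚ.* ε ≡ ε
  half+half ε = ≡.trans (≡.sym (ℚ.*-distribʳ-+ ε ½ ½)) (ℚ.*-identityˡ ε)

  half<self : ∀ {ε} → 0ℚ ℚ.< ε → ½ ℚ.* ε ℚ.< ε
  half<self {ε} 0<ε = begin-strict
    ½ ℚ.* ε                ≡⟨ ℚ.+-identityʳ _ ⟨
    ½ ℚ.* ε ℚ.+ 0ℚ         <⟨ ℚ.+-monoʳ-< (½ ℚ.* ε) (half-positive 0<ε) ⟩
    ½ ℚ.* ε ℚ.+ ½ ℚ.* ε    ≡⟨ half+half ε ⟩
    ε                      ∎
    where open ℚ.≤-Reasoning

  ∣∣-triangle : ∀ p q → ℚ.∣ p ∣ ℚ.≤ ℚ.∣ p ℚ.- q ∣ ℚ.+ ℚ.∣ q ∣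
  ∣∣-triangle p q = ≡.subst (λ r → ℚ.∣ r ∣ ℚ.≤ ℚ.∣ p ℚ.- q ∣ ℚ.+ ℚ.∣ q ∣)
    (≡.sym (difference+ p q)) (ℚ.∣p+q∣≤∣p∣+∣q∣ (p ℚ.- q) q)

  Eventually : Pred ℕ 0ℓ → Set
  Eventually P = ∃[ N ] (∀ n → N ℕ.≤ n → P n)

  eventually-map : ∀ {P Q : Pred ℕ 0ℓ} → (∀ n → P n → Q n) → Eventually P → Eventually Q
  eventually-map f (N , p) = N , λ n N≤n → f n (p n N≤n)

  eventually-zip : ∀ {P Q R : Pred ℕ 0ℓ} → (∀ n → P n → Q n → R n) →
                   Eventually P → Eventually Q → Eventually R
  eventually-zip f (M , p) (N , q) = M ℕ.⊔ N , λ n M⊔N≤n →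
    f n (p n (ℕ.m⊔n≤o⇒m≤o M N M⊔N≤n)) (q n (ℕ.m⊔n≤o⇒n≤o M N M⊔N≤n))

  -- x ≈ y unfolds to Null (λ n → seq x n ℚ.- seq y n).
  Null : Pred (ℕ → ℚ) 0ℓ
  Null s = ∀ ε → 0ℚ ℚ.< ε → Eventually (λ n → ℚ.∣ s n ∣ ℚ.< ε)

  null-resp : ∀ {s t} → (∀ n → s n ≡ t n) → Null s → Null t
  null-resp s≡t null ε 0<ε =
    eventually-map (λ n → ≡.subst (λ p → ℚ.∣ p ∣ ℚ.< ε) (s≡t n)) (null ε 0<ε)

  null-0 : Null (λ _ → 0ℚ)
  null-0 ε 0<ε = 0 , λ _ _ → 0<ε

  null-neg : ∀ {s} → Null s → Null (λ n → ℚ.- s n)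
  null-neg {s} null ε 0<ε =
    eventually-map (λ n → ≡.subst (ℚ._< ε) (≡.sym (ℚ.∣-p∣≡∣p∣ (s n)))) (null ε 0<ε)

  null-+ : ∀ {s t} → Null s → Null t → Null (λ n → s n ℚ.+ t n)
  null-+ {s} {t} null-s null-t ε 0<ε =
    eventually-zip sum<ε (null-s (½ ℚ.* ε) (half-positive 0<ε))
                         (null-t (½ ℚ.* ε) (half-positive 0<ε))
    where
    open ℚ.≤-Reasoning
    sum<ε : ∀ n → ℚ.∣ s n ∣ ℚ.< ½ ℚ.* ε → ℚ.∣ t n ∣ ℚ.< ½ ℚ.* ε → ℚ.∣ s n ℚ.+ t n ∣ ℚ.< ε
    sum<ε n s< t< = begin-strict
      ℚ.∣ s n ℚ.+ t n ∣          ≤⟨ ℚ.∣p+q∣≤∣p∣+∣q∣ (s n) (t n) ⟩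
      ℚ.∣ s n ∣ ℚ.+ ℚ.∣ t n ∣    <⟨ ℚ.+-mono-< s< t< ⟩
      ½ ℚ.* ε ℚ.+ ½ ℚ.* ε        ≡⟨ half+half ε ⟩
      ε                          ∎

  eventually-bounded : ∀ {s} → IsCauchy s →
    ∃[ K ] (ℚ.Positive K × Eventually (λ n → ℚ.∣ s n ∣ ℚ.< K))
  eventually-bounded {s} cauchy with cauchy 1ℚ (ℚ.positive⁻¹ 1ℚ)
  ... | N , close = K , ℚ.positive 0<K , N , λ n N≤n → begin-strict
    ℚ.∣ s n ∣                            ≤⟨ ∣∣-triangle (s n) (s N) ⟩
    ℚ.∣ s n ℚ.- s N ∣ ℚ.+ ℚ.∣ s N ∣      <⟨ ℚ.+-monoˡ-< ℚ.∣ s N ∣ (close n N N≤n ℕ.≤-refl) ⟩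
    K                                    ∎
    where
    open ℚ.≤-Reasoning
    K : ℚ
    K = 1ℚ ℚ.+ ℚ.∣ s N ∣
    0<K : 0ℚ ℚ.< K
    0<K = ℚ.+-mono-<-≤ (ℚ.positive⁻¹ 1ℚ) (ℚ.0≤∣p∣ (s N))

  positive-quotient : ∀ K ε → .{{ℚ.Positive K}} → .{{ℚ.Positive ε}} →
                      ∃[ δ ] (0ℚ ℚ.< δ × K ℚ.* δ ≡ ε)
  positive-quotient K ε = K⁻¹ ℚ.* ε , ℚ.positive⁻¹ (K⁻¹ ℚ.* ε) {{ℚ.pos*pos⇒pos K⁻¹ ε}} , (begin-equality
    K ℚ.* (K⁻¹ ℚ.* ε)    ≡⟨ ℚ.*-assoc K K⁻¹ ε ⟨
    K ℚ.* K⁻¹ ℚ.* ε      ≡⟨ ≡.cong (ℚ._* ε) (ℚ.*-inverseʳ K {{ℚ.pos⇒nonZero K}}) ⟩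
    1ℚ ℚ.* ε             ≡⟨ ℚ.*-identityˡ ε ⟩
    ε                    ∎)
    where
    open ℚ.≤-Reasoning
    K⁻¹ : ℚ
    K⁻¹ = (ℚ.1/ K) {{ℚ.pos⇒nonZero K}}
    instance
      K⁻¹-positive : ℚ.Positive K⁻¹
      K⁻¹-positive = ℚ.1/pos⇒pos K

  -- A Cauchy sequence is eventually bounded by some K > 0, so it suffices that t is eventually
  -- below ε / K.
  null-* : ∀ {s t} → IsCauchy s → Null t → Null (λ n → s n ℚ.* t n)
  null-* {s} {t} cauchy null ε 0<ε =
    let K , K-positive , s<K = eventually-bounded {s} cauchy
        δ , 0<δ , Kδ≡ε = positive-quotient K ε {{K-positive}} {{ℚ.positive 0<ε}}
    in eventually-zip (product<ε K {{K-positive}} Kδ≡ε) s<K (null δ 0<δ)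
    where
    open ℚ.≤-Reasoning
    product<ε : ∀ K .{{_ : ℚ.Positive K}} {δ} → K ℚ.* δ ≡ ε →
                ∀ n → ℚ.∣ s n ∣ ℚ.< K → ℚ.∣ t n ∣ ℚ.< δ → ℚ.∣ s n ℚ.* t n ∣ ℚ.< ε
    product<ε K {δ} Kδ≡ε n s< t< = begin-strict
      ℚ.∣ s n ℚ.* t n ∣          ≡⟨ ℚ.∣p*q∣≡∣p∣*∣q∣ (s n) (t n) ⟩
      ℚ.∣ s n ∣ ℚ.* ℚ.∣ t n ∣    ≤⟨ ℚ.*-monoʳ-≤-nonNeg ℚ.∣ t n ∣ {{ℚ.∣-∣-nonNeg (t n)}} (ℚ.<⇒≤ s<) ⟩
      K ℚ.* ℚ.∣ t n ∣            <⟨ ℚ.*-monoʳ-<-pos K t< ⟩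
      K ℚ.* δ                    ≡⟨ Kδ≡ε ⟩
      ε                          ∎

  -- Transfers the ring laws of ℚ to ℝ term by term.
  pointwise : ∀ {x y} → (∀ n → seq x n ≡ seq y n) → x ≈ y
  pointwise {x} {y} x≡y = null-resp {s = λ _ → 0ℚ}
    (λ n → ≡.sym (≡.trans (≡.cong (ℚ._- seq y n) (x≡y n)) (ℚ.+-inverseʳ (seq y n)))) null-0

-- The commutative ring of Cauchy reals

ℝ-commutativeRing : CommutativeRing 0ℓ 0ℓ
ℝ-commutativeRing = record
  { Carrier = ℝ ; _≈_ = _≈_ ; _+_ = _+_ ; _*_ = _*_ ; -_ = -_ ; 0# = 0ℝ ; 1# = 1ℝ
  ; isCommutativeRing = record
    { isRing = record
      { +-isAbelianGroup = record
        { isGroup = record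
          { isMonoid = record
            { isSemigroup = record
              { isMagma = record
                { isEquivalence = record
                  { refl  = λ {x} → pointwise {x} {x} (λ _ → ≡.refl)
                  ; sym   = λ {x} {y} x≈y → null-resp (λ n → neg-difference (seq x n) (seq y n))
                              (null-neg x≈y)
                  ; trans = λ {x} {y} {z} x≈y y≈z →
                              null-resp (λ n → telescope (seq x n) (seq y n) (seq z n))
                                (null-+ x≈y y≈z)
                  }
                ; ∙-cong = λ {x} {y} {u} {v} x≈y u≈v →
                    null-resp (λ n → +-difference (seq x n) (seq y n) (seq u n) (seq v n))
                      (null-+ x≈y u≈v)
                }
              ; assoc = λ x y z → pointwise {(x + y) + z} {x + (y + z)} λ n →
                  ℚ.+-assoc (seq x n) (seq y n) (seq z n)
              }
            ; identity = (λ x → pointwise {0ℝ + x} {x} λ n → ℚ.+-identityˡ (seq x n))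
                       , (λ x → pointwise {x + 0ℝ} {x} λ n → ℚ.+-identityʳ (seq x n))
            }
          ; inverse = (λ x → pointwise {(- x) + x} {0ℝ} λ n → ℚ.+-inverseˡ (seq x n))
                    , (λ x → pointwise {x + (- x)} {0ℝ} λ n → ℚ.+-inverseʳ (seq x n))
          ; ⁻¹-cong = λ {x} {y} x≈y →
              null-resp (λ n → ℚ.neg-distrib-+ (seq x n) (ℚ.- seq y n)) (null-neg x≈y)
          }
        ; comm = λ x y → pointwise {x + y} {y + x} λ n → ℚ.+-comm (seq x n) (seq y n)
        }
      ; *-cong = λ {x} {y} {u} {v} x≈y u≈v →
          null-resp (λ n → *-difference (seq x n) (seq y n) (seq u n) (seq v n))
            -- The difference x u - y v is x (u - v) + v (x - y), a sum of products of a Cauchy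
            -- sequence with a null sequence.
            (null-+ {λ n → seq x n ℚ.* (seq u n ℚ.- seq v n)} {λ n → seq v n ℚ.* (seq x n ℚ.- seq y n)}
              (null-* {seq x} (isCauchy x) u≈v) (null-* {seq v} (isCauchy v) x≈y))
      ; *-assoc = λ x y z → pointwise {(x * y) * z} {x * (y * z)} λ n →
          ℚ.*-assoc (seq x n) (seq y n) (seq z n)
      ; *-identity = (λ x → pointwise {1ℝ * x} {x} λ n → ℚ.*-identityˡ (seq x n))
                   , (λ x → pointwise {x * 1ℝ} {x} λ n → ℚ.*-identityʳ (seq x n))
      ; distrib = (λ x y z → pointwise {x * (y + z)} {x * y + x * z} λ n →
                    ℚ.*-distribˡ-+ (seq x n) (seq y n) (seq z n))
                , (λ x y z → pointwise {(y + z) * x} {y * x + z * x} λ n →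
                    ℚ.*-distribʳ-+ (seq x n) (seq y n) (seq z n))
      }
    ; *-comm = λ x y → pointwise {x * y} {y * x} λ n → ℚ.*-comm (seq x n) (seq y n)
    }
  }

-- Zero products and nonnegativity for Cauchy reals

private
  -- A constructive substitute for deciding whether the limit is zero. From the index `N` on, terms
  -- differ by less than ε/4, so one decidable comparison of the term at `N` with ε/2 settles the
  -- whole tail: it stays below ε or above ε/4.
  small-or-apart : ∀ {s} → IsCauchy s → ∀ ε → 0ℚ ℚ.< ε →
    Eventually (λ n → ℚ.∣ s n ∣ ℚ.< ε) ⊎
    ∃[ δ ] (0ℚ ℚ.< δ × Eventually (λ n → δ ℚ.< ℚ.∣ s n ∣))
  small-or-apart {s} cauchy ε 0<ε = helper (ℚ.∣ s N ∣ ℚ.<? h)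
    where
    open ℚ.≤-Reasoning
    h q : ℚ
    h = ½ ℚ.* ε
    q = ½ ℚ.* h

    0<h : 0ℚ ℚ.< h
    0<h = half-positive 0<ε

    N : ℕ
    N = proj₁ (cauchy q (half-positive 0<h))

    close : ∀ m n → N ℕ.≤ m → N ℕ.≤ n → ℚ.∣ s m ℚ.- s n ∣ ℚ.< q
    close = proj₂ (cauchy q (half-positive 0<h))

    helper : Dec (ℚ.∣ s N ∣ ℚ.< h) →
      Eventually (λ n → ℚ.∣ s n ∣ ℚ.< ε) ⊎
      ∃[ δ ] (0ℚ ℚ.< δ × Eventually (λ n → δ ℚ.< ℚ.∣ s n ∣))
    helper (yes sN<h) = inj₁ (N , λ n N≤n → begin-strict
      ℚ.∣ s n ∣                          ≤⟨ ∣∣-triangle (s n) (s N) ⟩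
      ℚ.∣ s n ℚ.- s N ∣ ℚ.+ ℚ.∣ s N ∣    <⟨ ℚ.+-mono-< (close n N N≤n ℕ.≤-refl) sN<h ⟩
      q ℚ.+ h                            <⟨ ℚ.+-monoˡ-< h (half<self 0<h) ⟩
      h ℚ.+ h                            ≡⟨ half+half ε ⟩
      ε                                  ∎)
    helper (no sN≮h) = inj₂ (q , half-positive 0<h , N , λ n N≤n → begin-strict
      q
        ≡⟨ cancel-double q ⟩
      ℚ.- q ℚ.+ (q ℚ.+ q)
        ≡⟨ ≡.cong (ℚ.- q ℚ.+_) (half+half h) ⟩
      ℚ.- q ℚ.+ h
        ≤⟨ ℚ.+-monoʳ-≤ (ℚ.- q) (ℚ.≮⇒≥ sN≮h) ⟩
      ℚ.- q ℚ.+ ℚ.∣ s N ∣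
        ≤⟨ ℚ.+-monoʳ-≤ (ℚ.- q) (∣∣-triangle (s N) (s n)) ⟩
      ℚ.- q ℚ.+ (ℚ.∣ s N ℚ.- s n ∣ ℚ.+ ℚ.∣ s n ∣)
        <⟨ ℚ.+-monoʳ-< (ℚ.- q) (ℚ.+-monoˡ-< ℚ.∣ s n ∣ (close N n ℕ.≤-refl N≤n)) ⟩
      ℚ.- q ℚ.+ (q ℚ.+ ℚ.∣ s n ∣)
        ≡⟨ cancel-neg q ℚ.∣ s n ∣ ⟩
      ℚ.∣ s n ∣
        ∎)

  -- Where |s| exceeds δ, a bound δ ε on |s t| forces |t| below ε.
  factor-null : ∀ (s t : ℕ → ℚ) {δ} → 0ℚ ℚ.< δ → Eventually (λ n → δ ℚ.< ℚ.∣ s n ∣) →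
    Null (λ n → s n ℚ.* t n) → Null t
  factor-null s t {δ} 0<δ δ<s null ε 0<ε =
    eventually-zip factor<ε δ<s (null (δ ℚ.* ε) (ℚ.positive⁻¹ (δ ℚ.* ε) {{ℚ.pos*pos⇒pos δ ε}}))
    where
    open ℚ.≤-Reasoning
    instance
      δ-pos : ℚ.Positive δ
      δ-pos = ℚ.positive 0<δ
      ε-pos : ℚ.Positive ε
      ε-pos = ℚ.positive 0<ε

    factor<ε : ∀ n → δ ℚ.< ℚ.∣ s n ∣ → ℚ.∣ s n ℚ.* t n ∣ ℚ.< δ ℚ.* ε → ℚ.∣ t n ∣ ℚ.< ε
    factor<ε n δ< st< = ℚ.*-cancelˡ-<-nonNeg δ {{ℚ.pos⇒nonNeg δ}} (begin-strict
      δ ℚ.* ℚ.∣ t n ∣            ≤⟨ ℚ.*-monoʳ-≤-nonNeg ℚ.∣ t n ∣ {{ℚ.∣-∣-nonNeg (t n)}} (ℚ.<⇒≤ δ<) ⟩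
      ℚ.∣ s n ∣ ℚ.* ℚ.∣ t n ∣    ≡⟨ ℚ.∣p*q∣≡∣p∣*∣q∣ (s n) (t n) ⟨
      ℚ.∣ s n ℚ.* t n ∣          <⟨ st< ⟩
      δ ℚ.* ε                    ∎)

  -- For each ε, either x is eventually below ε, as wanted, or x is bounded away from zero. In the
  -- second case y is null, and the hypothesis then makes x null.
  ℝ-split : ∀ {x y} → x * y ≈ 0ℝ → (y ≈ 0ℝ → x ≈ 0ℝ) → x ≈ 0ℝ
  ℝ-split {x} {y} xy≈0 y≈0⇒x≈0 ε 0<ε with small-or-apart {seq x} (isCauchy x) ε 0<ε
  ... | inj₁ small =
    eventually-map (λ n → ≡.subst (λ p → ℚ.∣ p ∣ ℚ.< ε) (≡.sym (ℚ.+-identityʳ (seq x n)))) small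
  ... | inj₂ (δ , 0<δ , δ<x) = y≈0⇒x≈0
    (null-resp (λ n → ≡.sym (ℚ.+-identityʳ (seq y n)))
      (factor-null (seq x) (seq y) 0<δ δ<x
        (null-resp (λ n → ℚ.+-identityʳ (seq x n ℚ.* seq y n)) xy≈0))) ε 0<ε

  -- A condition on every term of the representing sequence, so that closure under sums and
  -- products, and the case of squares, are inherited directly from ℚ.
  ℝ-NonNeg : Pred ℝ 0ℓ
  ℝ-NonNeg x = ∀ n → ℚ.NonNegative (seq x n)

  -- With both terms nonnegative, each term of x is bounded by the corresponding term of x + y.
  ℝ-summand-zero : ∀ {x y} → ℝ-NonNeg x → ℝ-NonNeg y → x + y ≈ 0ℝ → x ≈ 0ℝ
  ℝ-summand-zero {x} {y} x≥0 y≥0 x+y≈0 ε 0<ε = eventually-map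
    (λ n → ℚ.≤-<-trans (dominated (seq x n) (seq y n) {{x≥0 n}} {{y≥0 n}})) (x+y≈0 ε 0<ε)
    where
    open ℚ.≤-Reasoning
    dominated : ∀ p q → .{{ℚ.NonNegative p}} → .{{ℚ.NonNegative q}} →
                ℚ.∣ p ℚ.- 0ℚ ∣ ℚ.≤ ℚ.∣ p ℚ.+ q ℚ.- 0ℚ ∣
    dominated p q = begin
      ℚ.∣ p ℚ.- 0ℚ ∣          ≡⟨ ≡.cong ℚ.∣_∣ (ℚ.+-identityʳ p) ⟩
      ℚ.∣ p ∣                 ≡⟨ ℚ.0≤p⇒∣p∣≡p (ℚ.nonNegative⁻¹ p) ⟩
      p                       ≡⟨ ℚ.+-identityʳ p ⟨
      p ℚ.+ 0ℚ                ≤⟨ ℚ.+-monoʳ-≤ p (ℚ.nonNegative⁻¹ q) ⟩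
      p ℚ.+ q                 ≡⟨ ℚ.0≤p⇒∣p∣≡p 0≤p+q ⟨
      ℚ.∣ p ℚ.+ q ∣           ≡⟨ ≡.cong ℚ.∣_∣ (ℚ.+-identityʳ (p ℚ.+ q)) ⟨
      ℚ.∣ p ℚ.+ q ℚ.- 0ℚ ∣    ∎
      where
      0≤p+q : 0ℚ ℚ.≤ p ℚ.+ q
      0≤p+q = ℚ.nonNegative⁻¹ (p ℚ.+ q) {{ℚ.nonNeg+nonNeg⇒nonNeg p q}}

ℝ-formallyRealDomain : FormallyRealDomain 0ℓ 0ℓ 0ℓ
ℝ-formallyRealDomain = record
  { commutativeRing = ℝ-commutativeRing
  ; split           = λ {x} {y} → ℝ-split {x} {y}
  ; NonNeg          = ℝ-NonNeg
  ; 0-nonNeg        = λ _ → _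
  ; +-nonNeg        = λ {x} {y} x≥0 y≥0 n →
      ℚ.nonNeg+nonNeg⇒nonNeg (seq x n) {{x≥0 n}} (seq y n) {{y≥0 n}}
  ; *-nonNeg        = λ {x} {y} x≥0 y≥0 n →
      ℚ.nonNeg*nonNeg⇒nonNeg (seq x n) {{x≥0 n}} (seq y n) {{y≥0 n}}
  ; square-nonNeg   = λ x n → square-nonNegative (seq x n)
  ; summand-zero    = λ {x} {y} → ℝ-summand-zero {x} {y}
  }
  where
  square-nonNegative : ∀ p → ℚ.NonNegative (p ℚ.* p)
  square-nonNegative p with ℚ.≤-total 0ℚ p
  ... | inj₁ 0≤p = ℚ.nonNeg*nonNeg⇒nonNeg p {{ℚ.nonNegative 0≤p}} p {{ℚ.nonNegative 0≤p}}
  ... | inj₂ p≤0 = ℚ.nonPos*nonPos⇒nonPos p {{ℚ.nonPositive p≤0}} p {{ℚ.nonPositive p≤0}}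

theorem7 : ¬ FaithfulOrthogonalRepresentation H₂₁ 3
theorem7 r = Geometry.no-representation ℝ-formallyRealDomain vec nonzero orthogonal
  where open FaithfulOrthogonalRepresentation r
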